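{- Let $\mathcal{A}$ be a central and essential arrangement in $\mathbb{Q}^l$ as in the context, let $\sigma$ be a term ordering and $p$ a prime. Then the following are equivalent: (1) $p$ is good and $(\sigma,l)$-lucky for $\mathcal{A}$; (2) $\mathcal{A}$ and $\mathcal{A}_p$ are combinatorially equivalent.
   Context: $\mathcal{A}=\{H_1,\dots,H_n\}$ is an arrangement of $n$ distinct, linearly ordered linear hyperplanes in $\mathbb{Q}^l$ with $\bigcap_iH_i=\{0\}$. $H_i=\{\alpha_i=0\}$ with $\alpha_i\in\mathbb{Z}[x_1,\dots,x_l]$ a nonzero linear form whose coefficients are not all divisible by any prime; $Q(\mathcal{A})=\prod\alpha_i$. $\pi_p$ denotes reduction mod $p$ and $(\alpha_i)_p=\pi_p(\alpha_i)$; $p$ is good if $\pi_p(Q(\mathcal{A}))$ is reduced (no $(\alpha_i)_p$ is a scalar multiple of $(\alpha_j)_p$ for $i<j$). $\mathcal{A}_p=\{(H_1)_p,\dots,(H_n)_p\}$ is the arrangement (hyperplanes counted with the indexing) in $\mathbb{F}_p^l$ with $(H_i)_p=\{(\alpha_i)_p=0\}$. Two indexed families $\{H^{(1)}_i\}_{i=1}^n$ in $K_1^l$ and $\{H^{(2)}_i\}_{i=1}^n$ in $K_2^l$ are combinatorially equivalent if $\dim(H^{(1)}_{i_1}\cap\dots\cap H^{(1)}_{i_k})=\dim(H^{(2)}_{i_1}\cap\dots\cap H^{(2)}_{i_k})$ for all $1\le i_1<\dots<i_k\le n$ (dimension of $\emptyset$ is $-1$). Gröbner notions: for a term ordering $\sigma$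 and nonzero $f\in\mathbb{Z}[x_1,\dots,x_l]$, $\mathrm{LT}_\sigma(f)$ is the $\sigma$-largest term of $f$, $\mathrm{LC}_\sigma(f)$ its coefficient, $\mathrm{LM}_\sigma(f)=\mathrm{LC}_\sigma(f)\mathrm{LT}_\sigma(f)$. A finite set $G$ of nonzero elements of an ideal $I\subseteq\mathbb{Z}[x_1,\dots,x_l]$ is a minimal strong $\sigma$-Gröbner basis if it generates $I$, every nonzero $f\in I$ has $\mathrm{LM}_\sigma(f)$ divisible by some $\mathrm{LM}_\sigma(g)$, $g\in G$, and no $\mathrm{LM}_\sigma(g)$ divides $\mathrm{LM}_\sigma(g')$ for distinct $g,g'\in G$; the set of leading coefficients is independent of the choice. $p$ is $\sigma$-lucky for $I$ if $p$ divides no leading coefficient of a minimal strong $\sigma$-Gröbner basis of $I$. For $1\le k\le n$, $p$ is $(\sigma,k)$-lucky for $\mathcal{A}$ if $p$ is $\sigma$-lucky for every ideal $\langle\alpha_{i_1},\dots,\alpha_{i_k}\rangle\subseteq\mathbb{Z}[x_1,\dots,x_l]$ with $i_1<\dots<i_k$ and $\operatorname{codim}(H_{i_1}\cap\dots\cap H_{i_k})=k$. -}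

module Defs where

open import Algebra.Bundles using (CommutativeRing)
open import Data.Bool.Base using (if_then_else_)
open import Data.Fin.Base as Fin using (Fin)
open import Data.Integer.Base as ℤ using (ℤ; +_)
open import Data.Integer.Divisibility.Signed using (_∣_; divides; ∣m∣n⇒∣m+n; ∣m⇒∣-m; ∣n⇒∣m*n; ∣m⇒∣m*n)
import Data.Integer.Properties as ℤ
import Data.Integer.Tactic.RingSolver as ℤ-Solver
open import Data.List.Base using (List; []; _∷_; _++_; map; concatMap; tabulate; length; lookup)
open import Data.List.Membership.Propositional using (_∈_)
open import Data.List.Relation.Unary.All using (All)
open import Data.List.Relation.Unary.Any using (Any)
open import Data.Nat.Base as ℕ using (ℕ)
import Data.Nat.Properties as ℕ
open import Data.Nat.Primality using (Prime)
open import Data.Product.Base using (_×_; _,_; ∃; ∃-syntax; ∃₂)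
open import Data.Rational.Base as ℚ using (ℚ)
import Data.Rational.Properties as ℚ
open import Data.Sum.Base using (_⊎_)
open import Data.Vec.Base using (Vec; replicate; zipWith; _[_]≔_)
open import Data.Vec.Functional using (Vector; foldr)
open import Data.Vec.Properties using (≡-dec)
open import Function.Base using (_∘_)
open import Level using (Level; 0ℓ; _⊔_)
open import Relation.Binary.Core using (Rel)
open import Relation.Binary.PropositionalEquality using (_≡_; _≢_; refl; subst)
open import Relation.Binary.Structures using (IsStrictTotalOrder)
open import Relation.Nullary using (¬_; ⌊_⌋)
open import Relation.Unary using (Pred; _≐_)

------------------------------------------------------------------------
-- The ring ℤ/p: the carrier is ℤ itself and the equality is congruence
-- mod p, so that the reduction map π_p is the identity on carriers.

record _≡_[mod_] (a b : ℤ) (p : ℕ) : Set where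
  constructor mod
  field p∣a-b : + p ∣ a ℤ.- b

module _ (p : ℕ) where

  private
    infix 4 _~_
    _~_ : Rel ℤ 0ℓ
    a ~ b = a ≡ b [mod p ]

    reflexive : ∀ {a b} → a ≡ b → a ~ b
    reflexive {a} refl = mod (divides (+ 0) (ℤ.+-inverseʳ a))

    via : ∀ {a b z} → z ≡ a ℤ.- b → + p ∣ z → a ~ b
    via eq d = mod (subst (+ p ∣_) eq d)

    ~-sym : ∀ {a b} → a ~ b → b ~ a
    ~-sym {a} {b} (mod d) = via (lemma a b) (∣m⇒∣-m d)
      where lemma : ∀ a b → ℤ.- (a ℤ.- b) ≡ b ℤ.- a
            lemma = ℤ-Solver.solve-∀

    ~-trans : ∀ {a b c} → a ~ b → b ~ c → a ~ c
    ~-trans {a} {b} {c} (mod d) (mod e) = via (lemma a b c) (∣m∣n⇒∣m+n d e)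
      where lemma : ∀ a b c → (a ℤ.- b) ℤ.+ (b ℤ.- c) ≡ a ℤ.- c
            lemma = ℤ-Solver.solve-∀

    +-cong : ∀ {a b c d} → a ~ b → c ~ d → (a ℤ.+ c) ~ (b ℤ.+ d)
    +-cong {a} {b} {c} {d} (mod e) (mod f) = via (lemma a b c d) (∣m∣n⇒∣m+n e f)
      where lemma : ∀ a b c d → (a ℤ.- b) ℤ.+ (c ℤ.- d) ≡ (a ℤ.+ c) ℤ.- (b ℤ.+ d)
            lemma = ℤ-Solver.solve-∀

    *-cong : ∀ {a b c d} → a ~ b → c ~ d → (a ℤ.* c) ~ (b ℤ.* d)
    *-cong {a} {b} {c} {d} (mod e) (mod f) =
      via (lemma a b c d) (∣m∣n⇒∣m+n (∣m⇒∣m*n c e) (∣n⇒∣m*n b f))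
      where lemma : ∀ a b c d → (a ℤ.- b) ℤ.* c ℤ.+ b ℤ.* (c ℤ.- d) ≡ a ℤ.* c ℤ.- b ℤ.* d
            lemma = ℤ-Solver.solve-∀

    -‿cong : ∀ {a b} → a ~ b → (ℤ.- a) ~ (ℤ.- b)
    -‿cong {a} {b} (mod d) = via (lemma a b) (∣m⇒∣-m d)
      where lemma : ∀ a b → ℤ.- (a ℤ.- b) ≡ ℤ.- a ℤ.- ℤ.- b
            lemma = ℤ-Solver.solve-∀

  ℤ/_ : CommutativeRing 0ℓ 0ℓ
  ℤ/_ = record
    { Carrier = ℤ ; _≈_ = _~_ ; _+_ = ℤ._+_ ; _*_ = ℤ._*_ ; -_ = ℤ.-_ ; 0# = + 0 ; 1# = + 1
    ; isCommutativeRing = record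
      { isRing = record
        { +-isAbelianGroup = record
          { isGroup = record
            { isMonoid = record
              { isSemigroup = record
                { isMagma = record
                  { isEquivalence = record { refl = reflexive refl ; sym = ~-sym ; trans = ~-trans }
                  ; ∙-cong = +-cong
                  }
                ; assoc = λ a b c → reflexive (ℤ.+-assoc a b c)
                }
              ; identity = (λ a → reflexive (ℤ.+-identityˡ a)) , (λ a → reflexive (ℤ.+-identityʳ a))
              }
            ; inverse = (λ a → reflexive (ℤ.+-inverseˡ a)) , (λ a → reflexive (ℤ.+-inverseʳ a))
            ; ⁻¹-cong = -‿cong
            }
          ; comm = λ a b → reflexive (ℤ.+-comm a b)
          }
        ; *-cong = *-cong
        ; *-assoc = λ a b c → reflexive (ℤ.*-assoc a b c)
        ; *-identity = (λ a → reflexive (ℤ.*-identityˡ a)) , (λ a → reflexive (ℤ.*-identityʳ a))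
        ; distrib = (λ a b c → reflexive (ℤ.*-distribˡ-+ a b c)) , (λ a b c → reflexive (ℤ.*-distribʳ-+ a b c))
        }
      ; *-comm = λ a b → reflexive (ℤ.*-comm a b)
      }
    }

ℚ-ring : CommutativeRing 0ℓ 0ℓ
ℚ-ring = ℚ.+-*-commutativeRing

------------------------------------------------------------------------
-- Linear algebra in K^l.  K is only asked to be a commutative ring, but
-- is instantiated below with the fields ℚ and ℤ/p, p prime.

module Linear {c ℓ : Level} (K : CommutativeRing c ℓ) where

  open CommutativeRing K
  open import Algebra.Properties.Monoid.Sum +-monoid using (sum)

  Hyperplane : ∀ {l} → Vector Carrier l → Pred (Vector Carrier l) ℓ
  Hyperplane a v = sum (λ j → a j * v j) ≈ 0#

  Intersection : ∀ {l k} → (Fin k → Vector Carrier l) → Pred (Vector Carrier l) ℓ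
  Intersection a v = ∀ i → Hyperplane (a i) v

  combination : ∀ {l d} → Vector Carrier d → (Fin d → Vector Carrier l) → Vector Carrier l
  combination c b j = sum (λ i → c i * b i j)

  record IsBasis {l d} (V : Pred (Vector Carrier l) ℓ) (b : Fin d → Vector Carrier l) : Set (c ⊔ ℓ) where
    field
      contained   : ∀ i → V (b i)
      independent : ∀ c → (∀ j → combination c b j ≈ 0#) → ∀ i → c i ≈ 0#
      spanning    : ∀ v → V v → ∃[ c ] (∀ j → v j ≈ combination c b j)

  HasDim : ∀ {l} → Pred (Vector Carrier l) ℓ → ℕ → Set (c ⊔ ℓ)
  HasDim {l} V d = ∃[ b ] IsBasis {l} {d} V b

  HasCodim : ∀ {l} → Pred (Vector Carrier l) ℓ → ℕ → Set (c ⊔ ℓ)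
  HasCodim {l} V k = ∃[ d ] HasDim V d × d ℕ.+ k ≡ l

-- A k-tuple of indices i₁ < … < i_k.
Increasing : ∀ {k n} → (Fin k → Fin n) → Set
Increasing ι = ∀ {a b} → a Fin.< b → ι a Fin.< ι b

-- Only families of linear hyperplanes are compared, so every intersection
-- contains 0 and the convention dim ∅ = -1 never comes into play.
module _ {c₁ ℓ₁ c₂ ℓ₂} (K₁ : CommutativeRing c₁ ℓ₁) (K₂ : CommutativeRing c₂ ℓ₂) where

  private
    module K₁ = CommutativeRing K₁
    module K₂ = CommutativeRing K₂
    module L₁ = Linear K₁
    module L₂ = Linear K₂

  CombinatoriallyEquivalent : ∀ {l n} → (Fin n → Vector K₁.Carrier l) → (Fin n → Vector K₂.Carrier l) →
                              Set (c₁ ⊔ ℓ₁ ⊔ c₂ ⊔ ℓ₂)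
  CombinatoriallyEquivalent {n = n} a b =
    ∀ {k} → 1 ℕ.≤ k → (ι : Fin k → Fin n) → Increasing ι →
    ∃[ d ] L₁.HasDim (L₁.Intersection (a ∘ ι)) d × L₂.HasDim (L₂.Intersection (b ∘ ι)) d

------------------------------------------------------------------------
-- Polynomials over ℤ in l variables: finite formal sums of coefficient /
-- exponent-vector pairs, identified when all coefficients agree.  The same
-- exponent vector may be listed repeatedly, or with coefficient 0.

Term : ℕ → Set
Term l = Vec ℕ l

module _ {l : ℕ} where

  infixl 7 _·_
  _·_ : Term l → Term l → Term l
  _·_ = zipWith ℕ._+_

  𝟏 : Term l
  𝟏 = replicate l 0

  var : Fin l → Term l
  var j = 𝟏 [ j ]≔ 1

Poly : ℕ → Set
Poly l = List (ℤ × Term l)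

module _ {l : ℕ} where

  coeff : Poly l → Term l → ℤ
  coeff []            t = + 0
  coeff ((c , s) ∷ f) t = (if ⌊ ≡-dec ℕ._≟_ s t ⌋ then c else + 0) ℤ.+ coeff f t

  infix 4 _≈_ _≉_ _∣ₚ_
  _≈_ _≉_ : Rel (Poly l) 0ℓ
  f ≈ g = ∀ t → coeff f t ≡ coeff g t
  f ≉ g = ¬ f ≈ g

  0ₚ : Poly l
  0ₚ = []

  infixl 6 _+ₚ_
  infixl 7 _*ₚ_
  _+ₚ_ _*ₚ_ : Poly l → Poly l → Poly l
  _+ₚ_ = _++_
  f *ₚ g = concatMap (λ (a , s) → map (λ (b , t) → a ℤ.* b , s · t) g) f

  sumₚ : ∀ {k} → (Fin k → Poly l) → Poly l
  sumₚ = foldr _+ₚ_ 0ₚ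

  _∣ₚ_ : Rel (Poly l) 0ℓ
  f ∣ₚ g = ∃[ h ] g ≈ h *ₚ f

  ⟨_⟩ : ∀ {k} → (Fin k → Poly l) → Pred (Poly l) 0ℓ
  ⟨_⟩ {k} F f = ∃ λ (h : Fin k → Poly l) → f ≈ sumₚ (λ i → h i *ₚ F i)

  linearForm : Vector ℤ l → Poly l
  linearForm a = tabulate (λ j → a j , var j)

------------------------------------------------------------------------
-- Gröbner bases

record TermOrdering (l : ℕ) : Set₁ where
  infix 4 _<_
  field
    _<_                : Rel (Term l) 0ℓ
    isStrictTotalOrder : IsStrictTotalOrder _≡_ _<_
    ·-mono-<           : ∀ {s t} u → s < t → u · s < u · t
    𝟏-min              : ∀ {t} → t ≢ 𝟏 → 𝟏 < t

module Gröbner {l : ℕ} (σ : TermOrdering l) where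

  open TermOrdering σ

  -- Every f ≉ 0ₚ has exactly one leading term, and 0ₚ has none.
  record IsLT (f : Poly l) (t : Term l) : Set where
    field
      occurs  : coeff f t ≢ + 0
      largest : ∀ {s} → coeff f s ≢ + 0 → s ≡ t ⊎ s < t

  IsLC : Poly l → ℤ → Set
  IsLC f c = ∃[ t ] IsLT f t × c ≡ coeff f t

  IsLM : Poly l → Poly l → Set
  IsLM f m = ∃[ t ] IsLT f t × m ≡ (coeff f t , t) ∷ []

  _LM∣_ : Rel (Poly l) 0ℓ
  g LM∣ f = ∃₂ λ m m′ → IsLM g m × IsLM f m′ × m ∣ₚ m′

  record IsMinimalStrongGröbnerBasis (I : Pred (Poly l) 0ℓ) (G : List (Poly l)) : Set where
    field
      nonzero   : All (_≉ 0ₚ) G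
      contained : All I G
      generates : ∀ f → I f → ⟨ lookup G ⟩ f
      strong    : ∀ f → I f → f ≉ 0ₚ → Any (_LM∣ f) G
      minimal   : ∀ {g g′} → g ∈ G → g′ ∈ G → g ≉ g′ → ¬ g LM∣ g′

  -- The set of leading coefficients does not depend on the choice of G, so
  -- that quantifying over all G is the same as fixing one.
  Lucky : ℕ → Pred (Poly l) 0ℓ → Set
  Lucky p I = ∀ G → IsMinimalStrongGröbnerBasis I G →
              ∀ {g c} → g ∈ G → IsLC g c → ¬ + p ∣ c

------------------------------------------------------------------------
-- Arrangements

toℚ : ∀ {l} → Vector ℤ l → Vector ℚ l
toℚ a j = a j ℚ./ 1

-- A central essential arrangement, given by the coefficient vectors of the
-- linear forms α_i, of content 1, defining its hyperplanes.
record Arrangement (l n : ℕ) : Set where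
  open Linear ℚ-ring
  field
    α         : Fin n → Vector ℤ l
    nonzero   : ∀ i → ∃[ j ] α i j ≢ + 0
    coprime   : ∀ i {q} → Prime q → ¬ (∀ j → + q ∣ α i j)
    distinct  : ∀ {i i′} → i ≢ i′ → ¬ Hyperplane (toℚ (α i)) ≐ Hyperplane (toℚ (α i′))
    essential : ∀ v → Intersection (toℚ ∘ α) v → ∀ j → v j ≡ ℚ.0ℚ

module _ {l n : ℕ} (𝒜 : Arrangement l n) where

  open Arrangement 𝒜

  -- The coefficient vectors of the forms over ℚ and of the forms (α_i)_p.
  formsℚ : Fin n → Vector ℚ l
  formsℚ = toℚ ∘ α

  forms-mod : (p : ℕ) → Fin n → Vector (CommutativeRing.Carrier (ℤ/ p)) l
  forms-mod p = α

  Good : ℕ → Set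
  Good p = ∀ {i i′} → i Fin.< i′ →
           ¬ (∃[ c ] ∀ j → forms-mod p i j 𝔽.≈ c 𝔽.* forms-mod p i′ j)
    where module 𝔽 = CommutativeRing (ℤ/ p)

  LuckyFor : TermOrdering l → ℕ → ℕ → Set
  LuckyFor σ k p = (ι : Fin k → Fin n) → Increasing ι →
                   HasCodim (Intersection (formsℚ ∘ ι)) k →
                   Lucky p ⟨ linearForm ∘ α ∘ ι ⟩
    where open Linear ℚ-ring
          open Gröbner σ

  CombinatoriallyEquivalentMod : ℕ → Set
  CombinatoriallyEquivalentMod p = CombinatoriallyEquivalent ℚ-ring (ℤ/ p) formsℚ (forms-mod p)

{-# OPTIONS --safe #-}

-- For l forms with trivial rational intersection, p is lucky for the ideal I
-- they generate iff they stay independent mod p.  If p ∤ D and all D x_j lie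
-- in I, an element of I with leading term c t can be replaced by one with
-- leading term gcd(c, D) t, so p divides no leading coefficient of a minimal
-- basis.  Conversely, every x_j is the leading term of some element of a
-- minimal basis, and if their leading coefficients are units mod p, the linear
-- parts of these elements are triangular mod p with respect to σ, so a vector
-- killed mod p by the forms is 0 mod p.  Only this direction needs a Gröbner
-- basis to exist; as its conclusion is decidable, existence is needed only up
-- to double negation, which follows from Dickson's lemma without deciding
-- which terms occur as leading terms.
--
-- Luckiness thus says that l-tuples independent over ℚ are independent mod p,
-- and the converse always holds.  A maximal independent subfamily of a given
-- subfamily extends to an independent l-tuple over either field, so the ranks
-- over ℚ and mod p agree for all subfamilies.

module Submission where

open import Defs
open import Algebra.Bundles using (CommutativeRing)
open import Data.Empty using (⊥-elim)
open import Data.Fin.Base as Fin using (Fin; punchIn; toℕ; fromℕ<)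
open import Data.Fin.Induction using (spo-wellFounded)
open import Data.Fin.Properties as Fin using (all?; ¬∀⟶∃¬)
open import Data.Integer.Base as ℤ using (ℤ; +_; 0ℤ)
open import Data.Integer.Divisibility.Signed as ℤ
  using (_∣_; divides; _∣?_; ∣-trans; ∣m∣n⇒∣m+n; ∣m+n∣m⇒∣n; ∣m+n∣n⇒∣m; ∣m⇒∣m*n; ∣n⇒∣m*n)
import Data.Integer.Properties as ℤ
import Data.Integer.Tactic.RingSolver as ℤ-Solver
open import Data.List.Base using (List; []; _∷_; _++_; map; concat; tabulate; length; lookup; allFin)
open import Data.List.Extrema.Nat using (max; xs≤max)
open import Data.List.Membership.Propositional using (_∈_; find; lose)
open import Data.List.Membership.Propositional.Properties using (∈-allFin; ∈-++⁻; ∈-++⁺ˡ; ∈-++⁺ʳ; ∈-map⁺; ∈-map⁻)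
import Data.List.Properties as List
open import Data.List.Relation.Unary.All as All using (All; []; _∷_)
import Data.List.Relation.Unary.All.Properties as All
open import Data.List.Relation.Unary.Any as Any using (Any; here; there; _─_)
import Data.List.Relation.Unary.Any.Properties as Any
open import Data.Nat.Base as ℕ using (ℕ; zero; suc; s≤s; z≤n)
import Data.Nat.Divisibility as ℕ
open import Data.Nat.GCD using (gcd; gcd-GCD; gcd[m,n]∣m; gcd[m,n]∣n; module Bézout)
open import Data.Nat.Primality using (Prime; prime⇒irreducible; euclidsLemma; ¬prime[1])
import Data.Nat.Properties as ℕ
open import Data.Product.Base using (_×_; _,_; ∃; ∃-syntax; ∃₂; proj₁; proj₂)
open import Data.Rational.Base as ℚ using (ℚ; 0ℚ; 1ℚ)
import Data.Rational.Properties as ℚ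
open import Data.Rational.Unnormalised.Base as ℚᵘ using (mkℚᵘ; *≡*)
import Data.Rational.Unnormalised.Properties as ℚᵘ
open import Data.Sum.Base as Sum using (_⊎_; inj₁; inj₂; [_,_]′)
open import Data.Unit.Polymorphic.Base using (⊤; tt)
open import Data.Vec.Base as Vec using ([]; _∷_)
import Data.Vec.Properties as Vec
open import Data.Vec.Functional as Vector using (Vector; insertAt)
open import Data.Vec.Functional.Properties using (insertAt-lookup; insertAt-punchIn)
open import Function.Base using (_∘_; id)
open import Function.Bundles using (_⇔_; mk⇔)
open import Induction.WellFounded using (Acc; acc)
open import Level using (0ℓ; _⊔_)
import Relation.Binary.Construct.On as On
open import Relation.Binary.Definitions using (tri<; tri≈; tri>)
open import Relation.Binary.PropositionalEquality as ≡ using (_≡_; refl)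
open import Relation.Binary.Structures using (IsStrictTotalOrder)
open import Relation.Nullary using (¬_; Dec; yes; no)
open import Relation.Nullary.Decidable using (map′; decidable-stable; ¬¬-excluded-middle)
open import Relation.Nullary.Negation using (contradiction; ¬¬-map)
open import Relation.Unary using (Pred; _≐_; _⊆_; _∩_)

-- Luckiness quantifies over all minimal strong bases of an ideal, so it says nothing until such a
-- basis is known to exist, and over `ℤ` this requires control of coefficients as well as of terms.
-- The constant `D` provides it: it is the product of the pivots of a fraction-free elimination. A
-- gcd with `D ≠ 0` is at most `|D|`, so only finitely many leading coefficients matter, and
-- Dickson's lemma applies to terms labelled by them. The same elimination compares the two kernels.
-- Over the integers it makes `D` nonzero, modulo `p` it makes `D` not divisible by `p`; the second
-- property contains the first, which is why independence mod `p` implies independence over `ℚ`.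
-- Ranks are compared by counting forms, never by transporting bases of intersections: these bases
-- live over different fields, whereas a list of indices makes sense over both.

-- Increasing enumerations of lists of indices

preds : ∀ {n} → List (Fin (suc n)) → List (Fin n)
preds []                = []
preds (Fin.zero ∷ xs)   = preds xs
preds (Fin.suc i ∷ xs)  = i ∷ preds xs

∈-preds⁺ : ∀ {n} {i : Fin n} {xs} → Fin.suc i ∈ xs → i ∈ preds xs
∈-preds⁺ {xs = Fin.zero ∷ xs}  (there i∈)  = ∈-preds⁺ i∈
∈-preds⁺ {xs = Fin.suc _ ∷ xs} (here refl) = here refl
∈-preds⁺ {xs = Fin.suc _ ∷ xs} (there i∈)  = there (∈-preds⁺ i∈)

∈-preds⁻ : ∀ {n} {i : Fin n} {xs} → i ∈ preds xs → Fin.suc i ∈ xs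
∈-preds⁻ {xs = Fin.zero ∷ xs}  i∈          = there (∈-preds⁻ i∈)
∈-preds⁻ {xs = Fin.suc _ ∷ xs} (here refl) = here refl
∈-preds⁻ {xs = Fin.suc _ ∷ xs} (there i∈)  = there (∈-preds⁻ i∈)

length-preds-≤ : ∀ {n} (xs : List (Fin (suc n))) → length (preds xs) ℕ.≤ length xs
length-preds-≤ []               = ℕ.z≤n
length-preds-≤ (Fin.zero ∷ xs)  = ℕ.m≤n⇒m≤1+n (length-preds-≤ xs)
length-preds-≤ (Fin.suc i ∷ xs) = s≤s (length-preds-≤ xs)

length-preds-< : ∀ {n} {xs : List (Fin (suc n))} → Fin.zero ∈ xs → length (preds xs) ℕ.< length xs
length-preds-< {xs = Fin.zero ∷ xs}  _           = s≤s (length-preds-≤ xs)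
length-preds-< {xs = Fin.suc _ ∷ xs} (there 0∈)  = s≤s (length-preds-< 0∈)

record IncreasingEnumeration {n} (xs : List (Fin n)) (m : ℕ) : Set where
  field
    index      : Fin m → Fin n
    increasing : Increasing index
    sound      : ∀ a → index a ∈ xs
    complete   : ∀ {i} → i ∈ xs → ∃[ a ] index a ≡ i

-- Index tuples have to be strictly increasing, whereas greedy choices come as lists. Repetitions
-- collapse, hence only `m ≤ length xs`; where the exact number matters, a dimension count supplies
-- the other inequality.
enumerate : ∀ {n} (xs : List (Fin n)) → ∃[ m ] m ℕ.≤ length xs × IncreasingEnumeration xs m
enumerate {zero}  xs = 0 , ℕ.z≤n , record { index = λ () ; increasing = λ {a} → λ {} ; sound = λ () ; complete = λ {} }
enumerate {suc n} xs with m , m≤ , enum ← enumerate (preds xs) with Any.any? (Fin.zero Fin.≟_) xs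
... | no 0∉ = m , ℕ.≤-trans m≤ (length-preds-≤ xs) , record
  { index      = Fin.suc ∘ index
  ; increasing = λ a<b → s≤s (increasing a<b)
  ; sound      = λ a → ∈-preds⁻ (sound a)
  ; complete   = λ { {Fin.zero} 0∈ → ⊥-elim (0∉ 0∈) ; {Fin.suc i} i∈ → let a , eq = complete (∈-preds⁺ i∈) in a , ≡.cong Fin.suc eq }
  } where
  open IncreasingEnumeration enum
... | yes 0∈ = suc m , ℕ.≤-trans (s≤s m≤) (length-preds-< 0∈) , record
  { index      = Fin.zero Vector.∷ (Fin.suc ∘ index)
  ; increasing = λ { {Fin.zero} {Fin.suc b} _ → s≤s ℕ.z≤n ; {Fin.suc a} {Fin.suc b} (s≤s a<b) → s≤s (increasing a<b) }
  ; sound      = λ { Fin.zero → 0∈ ; (Fin.suc a) → ∈-preds⁻ (sound a) }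
  ; complete   = λ { {Fin.zero} _ → Fin.zero , refl ; {Fin.suc i} i∈ → let a , eq = complete (∈-preds⁺ i∈) in Fin.suc a , ≡.cong Fin.suc eq }
  } where
  open IncreasingEnumeration enum

-- Linear algebra over a field with decidable zero test

record IsField {c ℓ} (K : CommutativeRing c ℓ) : Set (c ⊔ ℓ) where
  open CommutativeRing K using (_*_; 0#; 1#) renaming (_≈_ to _≃_)
  field
    _≟0     : ∀ x → Dec (x ≃ 0#)
    1≉0     : ¬ 1# ≃ 0#
    inverse : ∀ x → ¬ x ≃ 0# → ∃[ y ] y * x ≃ 1#

module FieldLinear {c ℓ} (K : CommutativeRing c ℓ) (isField : IsField K) where

  open IsField isField
  open CommutativeRing K hiding (_≉_; refl; zero) renaming (_≈_ to _≃_)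
  open Linear K
  open import Algebra.Properties.Semiring.Sum semiring
    using (sum; sum-cong-≋; sum-replicate-zero; sum-remove; ∑-distrib-+; ∑-comm; *-distribˡ-sum)
  open import Algebra.Properties.Ring ring using (-‿distribˡ-*; -‿distribʳ-*)
  open import Algebra.Properties.Group +-group using (inverseˡ-unique)
  open import Algebra.Properties.CommutativeSemigroup *-commutativeSemigroup using (x∙yz≈y∙xz)
  open import Relation.Binary.Reasoning.Setoid setoid

  dot : ∀ {l} → Vector Carrier l → Vector Carrier l → Carrier
  dot a v = sum (λ j → a j * v j)

  sum-zero : ∀ {n} {f : Vector Carrier n} → (∀ i → f i ≃ 0#) → sum f ≃ 0#
  sum-zero {n} f≈0 = trans (sum-cong-≋ f≈0) (sum-replicate-zero n)

  dot-comm : ∀ {l} (a v : Vector Carrier l) → dot a v ≃ dot v a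
  dot-comm a v = sum-cong-≋ (λ j → *-comm (a j) (v j))

  dot-congʳ : ∀ {l} (a : Vector Carrier l) {v w} → (∀ j → v j ≃ w j) → dot a v ≃ dot a w
  dot-congʳ a v≈w = sum-cong-≋ (λ j → *-congˡ (v≈w j))

  dot-+* : ∀ {l} (a v w : Vector Carrier l) k → dot a (λ j → v j + k * w j) ≃ dot a v + k * dot a w
  dot-+* a v w k = begin
    dot a (λ j → v j + k * w j)                       ≈⟨ sum-cong-≋ (λ j → distribˡ (a j) (v j) (k * w j)) ⟩
    sum (λ j → a j * v j + a j * (k * w j))           ≈⟨ ∑-distrib-+ (λ j → a j * v j) (λ j → a j * (k * w j)) ⟩
    dot a v + sum (λ j → a j * (k * w j))             ≈⟨ +-congˡ (sum-cong-≋ (λ j → x∙yz≈y∙xz (a j) k (w j))) ⟩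
    dot a v + sum (λ j → k * (a j * w j))             ≈⟨ +-congˡ (*-distribˡ-sum k (λ j → a j * w j)) ⟨
    dot a v + k * dot a w                             ∎

  dot-combination : ∀ {l d} (a : Vector Carrier l) (x : Vector Carrier d) (b : Fin d → Vector Carrier l) →
                    dot a (combination x b) ≃ dot x (λ i → dot a (b i))
  dot-combination a x b = begin
    sum (λ j → a j * sum (λ i → x i * b i j))    ≈⟨ sum-cong-≋ (λ j → *-distribˡ-sum (a j) (λ i → x i * b i j)) ⟩
    sum (λ j → sum (λ i → a j * (x i * b i j)))  ≈⟨ ∑-comm (λ j i → a j * (x i * b i j)) ⟩
    sum (λ i → sum (λ j → a j * (x i * b i j)))  ≈⟨ sum-cong-≋ (λ i → sum-cong-≋ (λ j → x∙yz≈y∙xz (a j) (x i) (b i j))) ⟩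
    sum (λ i → sum (λ j → x i * (a j * b i j)))  ≈⟨ sum-cong-≋ (λ i → *-distribˡ-sum (x i) (λ j → a j * b i j)) ⟨
    dot x (λ i → dot a (b i))                    ∎

  IsSubspace : ∀ {l} → Pred (Vector Carrier l) ℓ → Set (c ⊔ ℓ)
  IsSubspace V = ∀ v w k → V v → V w → V (λ j → v j + k * w j)

  hyperplane-isSubspace : ∀ {l} (a : Vector Carrier l) → IsSubspace (Hyperplane a)
  hyperplane-isSubspace a v w k av≈0 aw≈0 = begin
    dot a (λ j → v j + k * w j)  ≈⟨ dot-+* a v w k ⟩
    dot a v + k * dot a w        ≈⟨ +-cong av≈0 (trans (*-congˡ aw≈0) (zeroʳ k)) ⟩
    0# + 0#                      ≈⟨ +-identityˡ 0# ⟩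
    0#                           ∎

  ∩-isSubspace : ∀ {l} {V W : Pred (Vector Carrier l) ℓ} → IsSubspace V → IsSubspace W → IsSubspace (V ∩ W)
  ∩-isSubspace V-sub W-sub v w k (p , q) (r , s) = V-sub v w k p r , W-sub v w k q s

  HasDim-resp-≐ : ∀ {l d} {V W : Pred (Vector Carrier l) ℓ} → V ≐ W → HasDim V d → HasDim W d
  HasDim-resp-≐ (V⊆W , W⊆V) (b , basis) = b , record
    { contained   = λ i → V⊆W (contained i)
    ; independent = independent
    ; spanning    = λ v v∈W → spanning v (W⊆V v∈W)
    } where
    open IsBasis basis

  zero-dim : ∀ {l d} {V : Pred (Vector Carrier l) ℓ} → (∀ {v} → V v → ∀ j → v j ≃ 0#) → HasDim V d → d ≡ 0
  zero-dim {d = zero}  V≈0 _           = refl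
  zero-dim {d = suc d} V≈0 (b , basis) = ⊥-elim (1≉0 (independent (λ _ → 1#)
    (λ j → sum-zero (λ i → trans (*-congˡ (V≈0 (contained i) j)) (zeroʳ 1#))) Fin.zero))
    where
    open IsBasis basis

  δ : ∀ {l} → Fin l → Vector Carrier l
  δ Fin.zero    Fin.zero    = 1#
  δ Fin.zero    (Fin.suc j) = 0#
  δ (Fin.suc i) Fin.zero    = 0#
  δ (Fin.suc i) (Fin.suc j) = δ i j

  combination-δ : ∀ {l} (x : Vector Carrier l) j → combination x δ j ≃ x j
  combination-δ x Fin.zero = begin
    x Fin.zero * 1# + sum (λ i → x (Fin.suc i) * 0#)  ≈⟨ +-cong (*-identityʳ _) (sum-zero (λ i → zeroʳ (x (Fin.suc i)))) ⟩
    x Fin.zero + 0#                                   ≈⟨ +-identityʳ _ ⟩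
    x Fin.zero                                        ∎
  combination-δ x (Fin.suc j) = begin
    x Fin.zero * 0# + combination (x ∘ Fin.suc) δ j  ≈⟨ +-cong (zeroʳ _) (combination-δ (x ∘ Fin.suc) j) ⟩
    0# + x (Fin.suc j)                               ≈⟨ +-identityˡ _ ⟩
    x (Fin.suc j)                                    ∎

  full-dim : ∀ l → HasDim {l} (λ _ → ⊤) l
  full-dim l = δ , record
    { contained   = λ _ → tt
    ; independent = λ x x≈0 j → trans (sym (combination-δ x j)) (x≈0 j)
    ; spanning    = λ v _ → v , λ j → sym (combination-δ v j)
    }

  -- Gaussian pivoting: if α b_i ≠ 0, subtracting multiples of b_i from the
  -- other basis vectors moves them into the kernel of α.
  module _ {l d} {V : Pred (Vector Carrier l) ℓ} (V-sub : IsSubspace V)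
           {b : Fin (suc d) → Vector Carrier l} (basis : IsBasis V b)
           (α : Vector Carrier l) (i : Fin (suc d)) (αbᵢ≉0 : ¬ dot α (b i) ≃ 0#) where

    open IsBasis basis

    private
      u⁻¹ : Carrier
      u⁻¹ = proj₁ (inverse (dot α (b i)) αbᵢ≉0)

      u⁻¹u≈1 : u⁻¹ * dot α (b i) ≃ 1#
      u⁻¹u≈1 = proj₂ (inverse (dot α (b i)) αbᵢ≉0)

      t : Vector Carrier d
      t j = - (u⁻¹ * dot α (b (punchIn i j)))

      b′ : Fin d → Vector Carrier l
      b′ j m = b (punchIn i j) m + t j * b i m

      -- Passing from `b` to `b′` only affects the coefficient at `b i`, which becomes `dot x t`.
      -- Independence follows by inserting this coefficient, spanning because vanishing of `α`
      -- forces it.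
      combination-b′ : ∀ x m → combination x b′ m ≃ dot x t * b i m + combination x (b ∘ punchIn i) m
      combination-b′ x m = begin
        sum (λ j → x j * (b (punchIn i j) m + t j * b i m))
          ≈⟨ sum-cong-≋ (λ j → trans (distribˡ _ _ _) (+-congˡ (trans (*-congˡ (*-comm _ _)) (x∙yz≈y∙xz (x j) (b i m) (t j))))) ⟩
        sum (λ j → x j * b (punchIn i j) m + b i m * (x j * t j)) ≈⟨ ∑-distrib-+ (λ j → x j * b (punchIn i j) m) (λ j → b i m * (x j * t j)) ⟩
        combination x (b ∘ punchIn i) m + sum (λ j → b i m * (x j * t j)) ≈⟨ +-congˡ (*-distribˡ-sum (b i m) (λ j → x j * t j)) ⟨
        combination x (b ∘ punchIn i) m + b i m * dot x t   ≈⟨ +-congˡ (*-comm _ _) ⟩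
        combination x (b ∘ punchIn i) m + dot x t * b i m   ≈⟨ +-comm _ _ ⟩
        dot x t * b i m + combination x (b ∘ punchIn i) m   ∎

    pivot-dim : HasDim (V ∩ Hyperplane α) d
    pivot-dim = b′ , record
      { contained   = λ j → V-sub _ _ (t j) (contained (punchIn i j)) (contained i) , αb′ j
      ; independent = ind
      ; spanning    = span
      }
      where
      αb′ : ∀ j → dot α (b′ j) ≃ 0#
      αb′ j = begin
        dot α (b′ j)                                       ≈⟨ dot-+* α (b (punchIn i j)) (b i) (t j) ⟩
        y + - (u⁻¹ * y) * u                                ≈⟨ +-congˡ (-‿distribˡ-* (u⁻¹ * y) u) ⟨
        y + - (u⁻¹ * y * u)                                ≈⟨ +-congˡ (-‿cong (trans (*-congʳ (*-comm _ _)) (trans (*-assoc _ _ _) (*-congˡ u⁻¹u≈1)))) ⟩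
        y + - (y * 1#)                                     ≈⟨ +-congˡ (-‿cong (*-identityʳ y)) ⟩
        y + - y                                            ≈⟨ -‿inverseʳ y ⟩
        0#                                                 ∎
        where y = dot α (b (punchIn i j)) ; u = dot α (b i)

      ind : ∀ x → (∀ m → combination x b′ m ≃ 0#) → ∀ j → x j ≃ 0#
      ind x xb′≈0 j = trans (reflexive (≡.sym (insertAt-punchIn x i (dot x t) j))) (independent x′ x′b≈0 (punchIn i j))
        where
        x′ = insertAt x i (dot x t)
        x′b≈0 : ∀ m → combination x′ b m ≃ 0#
        x′b≈0 m = begin
          combination x′ b m                                               ≈⟨ sum-remove {i = i} (λ k → x′ k * b k m) ⟩
          x′ i * b i m + combination (x′ ∘ punchIn i) (b ∘ punchIn i) m    ≈⟨ +-cong (*-congʳ (reflexive (insertAt-lookup x i (dot x t))))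
                                                                                     (sum-cong-≋ (λ k → *-congʳ (reflexive (insertAt-punchIn x i (dot x t) k)))) ⟩
          dot x t * b i m + combination x (b ∘ punchIn i) m                ≈⟨ combination-b′ x m ⟨
          combination x b′ m                                               ≈⟨ xb′≈0 m ⟩
          0#                                                               ∎

      span : ∀ v → (V ∩ Hyperplane α) v → ∃[ x ] (∀ m → v m ≃ combination x b′ m)
      span v (v∈V , αv≈0) with x , v≈xb ← spanning v v∈V = x′ , λ m → begin
        v m                                                  ≈⟨ v≈xb m ⟩
        combination x b m                                    ≈⟨ sum-remove {i = i} (λ k → x k * b k m) ⟩
        x i * b i m + combination x′ (b ∘ punchIn i) m       ≈⟨ +-congʳ (*-congʳ xᵢ) ⟩
        dot x′ t * b i m + combination x′ (b ∘ punchIn i) m  ≈⟨ combination-b′ x′ m ⟨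
        combination x′ b′ m                                  ∎
        where
        x′ = x ∘ punchIn i
        s = dot x′ (λ j → dot α (b (punchIn i j)))
        relation : x i * dot α (b i) + s ≃ 0#
        relation = begin
          x i * dot α (b i) + s           ≈⟨ sum-remove {i = i} (λ k → x k * dot α (b k)) ⟨
          dot x (λ k → dot α (b k))       ≈⟨ dot-combination α x b ⟨
          dot α (combination x b)         ≈⟨ dot-congʳ α v≈xb ⟨
          dot α v                         ≈⟨ αv≈0 ⟩
          0#                              ∎
        dot-t : dot x′ t ≃ - u⁻¹ * s
        dot-t = begin
          sum (λ j → x′ j * t j)                                            ≈⟨ sum-cong-≋ (λ j → trans (*-congˡ (-‿distribˡ-* u⁻¹ _)) (x∙yz≈y∙xz (x′ j) (- u⁻¹) _)) ⟩
          sum (λ j → - u⁻¹ * (x′ j * dot α (b (punchIn i j))))              ≈⟨ *-distribˡ-sum (- u⁻¹) (λ j → x′ j * dot α (b (punchIn i j))) ⟨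
          - u⁻¹ * s                                                         ∎
        xᵢ : x i ≃ dot x′ t
        xᵢ = begin
          x i                              ≈⟨ *-identityʳ (x i) ⟨
          x i * 1#                         ≈⟨ *-congˡ u⁻¹u≈1 ⟨
          x i * (u⁻¹ * dot α (b i))        ≈⟨ x∙yz≈y∙xz (x i) u⁻¹ _ ⟩
          u⁻¹ * (x i * dot α (b i))        ≈⟨ *-congˡ (inverseˡ-unique _ _ relation) ⟩
          u⁻¹ * - s                        ≈⟨ -‿distribʳ-* u⁻¹ s ⟨
          - (u⁻¹ * s)                      ≈⟨ -‿distribˡ-* u⁻¹ s ⟩
          - u⁻¹ * s                        ≈⟨ dot-t ⟨
          dot x′ t                         ∎

  -- It suffices to test `α` on the finitely many basis vectors: either all are killed, and then all
  -- of `V`, or one of them is a pivot and the dimension drops by exactly one.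
  cut-dim : ∀ {l d} {V : Pred (Vector Carrier l) ℓ} → IsSubspace V → HasDim V d → (α : Vector Carrier l) →
            V ⊆ Hyperplane α ⊎ ∃[ d′ ] d ≡ suc d′ × HasDim (V ∩ Hyperplane α) d′
  cut-dim {d = d} {V} V-sub (b , basis) α with all? (λ i → dot α (b i) ≟0)
  ... | yes αb≈0 = inj₁ λ {v} v∈V → let x , v≈xb = spanning v v∈V in begin
    dot α v                    ≈⟨ dot-congʳ α v≈xb ⟩
    dot α (combination x b)    ≈⟨ dot-combination α x b ⟩
    dot x (λ i → dot α (b i))  ≈⟨ sum-zero (λ i → trans (*-congˡ (αb≈0 i)) (zeroʳ (x i))) ⟩
    0#                         ∎
    where
    open IsBasis basis
  cut-dim {d = zero}  V-sub (b , basis) α | no ¬αb≈0 = ⊥-elim (¬αb≈0 λ ())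
  cut-dim {d = suc d} V-sub (b , basis) α | no ¬αb≈0 with i , αbᵢ≉0 ← ¬∀⟶∃¬ _ _ (λ i → dot α (b i) ≟0) ¬αb≈0 =
    inj₂ (d , refl , pivot-dim V-sub basis α i αbᵢ≉0)

  module _ {l n} (a : Fin n → Vector Carrier l) where

    Killed : List (Fin n) → Pred (Vector Carrier l) ℓ
    Killed is v = All (λ i → Hyperplane (a i) v) is

    private
      assoc-∩ : ∀ {V : Pred (Vector Carrier l) ℓ} {i is} → ((V ∩ Hyperplane (a i)) ∩ Killed is) ≐ (V ∩ Killed (i ∷ is))
      assoc-∩ = (λ ((p , q) , r) → p , q ∷ r) , λ { (p , q ∷ r) → (p , q) , r }

    dim-drop : ∀ {V : Pred (Vector Carrier l) ℓ} {d} → IsSubspace V → HasDim V d → ∀ is → ∃[ d′ ] HasDim (V ∩ Killed is) d′ × d ℕ.≤ length is ℕ.+ d′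
    dim-drop {d = d} V-sub V-dim [] = d , HasDim-resp-≐ ((λ p → p , []) , proj₁) V-dim , ℕ.≤-refl
    dim-drop V-sub V-dim (i ∷ is) with cut-dim V-sub V-dim (a i)
    ... | inj₁ V⊆H with d′ , dim , d≤ ← dim-drop V-sub V-dim is =
      d′ , HasDim-resp-≐ ((λ (p , r) → p , V⊆H p ∷ r) , λ { (p , q ∷ r) → p , r }) dim , ℕ.m≤n⇒m≤1+n d≤
    ... | inj₂ (_ , refl , dim-V∩H) with d′ , dim , d≤ ← dim-drop (∩-isSubspace V-sub (hyperplane-isSubspace (a i))) dim-V∩H is =
      d′ , HasDim-resp-≐ assoc-∩ dim , s≤s d≤

    -- Greedy choice: a form is kept only if it cuts the current subspace properly. The kept forms
    -- therefore account for the whole drop in dimension and imply the dropped ones. `V` is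
    -- arbitrary so that a second round can start where a first one ended.
    pivots : ∀ {V : Pred (Vector Carrier l) ℓ} {d} → IsSubspace V → HasDim V d → ∀ is →
             ∃₂ λ E d′ → HasDim (V ∩ Killed E) d′ × length E ℕ.+ d′ ≡ d × (V ∩ Killed E) ⊆ Killed is × (∀ {e} → e ∈ E → e ∈ is)
    pivots {d = d} V-sub V-dim [] = [] , d , HasDim-resp-≐ ((λ p → p , []) , proj₁) V-dim , refl , proj₂ , λ ()
    pivots V-sub V-dim (i ∷ is) with cut-dim V-sub V-dim (a i)
    ... | inj₁ V⊆H with E , d′ , dim , eq , kill , sub ← pivots V-sub V-dim is =
      E , d′ , dim , eq , (λ { (p , r) → V⊆H p ∷ kill (p , r) }) , there ∘ sub
    ... | inj₂ (_ , refl , dim-V∩H)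
        with E , d′ , dim , eq , kill , sub ← pivots (∩-isSubspace V-sub (hyperplane-isSubspace (a i))) dim-V∩H is =
      i ∷ E , d′ , HasDim-resp-≐ assoc-∩ dim , ≡.cong suc eq , (λ { (p , q ∷ r) → q ∷ kill ((p , q) , r) }) ,
      λ { (here e≡i) → here e≡i ; (there e∈E) → there (sub e∈E) }

    Killed-allFin : Killed (allFin n) ⊆ Intersection a
    Killed-allFin p i = All.lookup p (∈-allFin i)

    -- Each equation costs at most one dimension, so `n` of them can reduce dimension `l` to 0 only
    -- if `l ≤ n`. Monotonicity and uniqueness of dimension rest on this count.
    trivial⇒dim≤ : (∀ {v} → Intersection a v → ∀ j → v j ≃ 0#) → l ℕ.≤ n
    trivial⇒dim≤ a≈0
      with d′ , dim , l≤ ← dim-drop {V = λ _ → ⊤} (λ _ _ _ _ _ → tt) (full-dim l) (allFin n)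
      with refl ← zero-dim (λ (_ , p) → a≈0 (Killed-allFin p)) dim
      = ℕ.≤-trans l≤ (ℕ.≤-reflexive (≡.trans (ℕ.+-identityʳ _) (List.length-tabulate {n = n} _)))

  -- The coordinates of `b` with respect to `b′` form `d′` equations in `d` unknowns. A solution is
  -- a linear relation among the `b i`, hence trivial, and `trivial⇒dim≤` applies.
  dim-mono : ∀ {l d d′} {V W : Pred (Vector Carrier l) ℓ} → V ⊆ W → HasDim V d → HasDim W d′ → d ℕ.≤ d′
  dim-mono {d = d} {d′} V⊆W (b , b-basis) (b′ , b′-basis) = trivial⇒dim≤ (λ k i → coords i k) λ {x} x∈ker →
    B.independent x λ j → begin
      sum (λ i → x i * b i j)                              ≈⟨ sum-cong-≋ (λ i → *-congˡ (proj₂ (expand i) j)) ⟩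
      sum (λ i → x i * sum (λ k → coords i k * b′ k j))    ≈⟨ sum-cong-≋ (λ i → *-congˡ (dot-comm (coords i) (λ k → b′ k j))) ⟩
      dot x (λ i → dot (λ k → b′ k j) (coords i))          ≈⟨ dot-combination (λ k → b′ k j) x coords ⟨
      dot (λ k → b′ k j) (combination x coords)            ≈⟨ sum-zero (λ k → trans (*-congˡ (trans (dot-comm x (λ i → coords i k)) (x∈ker k))) (zeroʳ _)) ⟩
      0#                                                   ∎
    where
    module B = IsBasis b-basis
    module B′ = IsBasis b′-basis
    expand : ∀ i → ∃[ y ] (∀ j → b i j ≃ combination y b′ j)
    expand i = B′.spanning (b i) (V⊆W (B.contained i))
    coords : Fin d → Vector Carrier d′
    coords i = proj₁ (expand i)

  dim-unique : ∀ {l d d′} {V : Pred (Vector Carrier l) ℓ} → HasDim V d → HasDim V d′ → d ≡ d′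
  dim-unique p q = ℕ.≤-antisym (dim-mono (λ v∈V → v∈V) p q) (dim-mono (λ v∈V → v∈V) q p)

  trivial-dim : ∀ {l} {V : Pred (Vector Carrier l) ℓ} → (∀ {v} → V v → ∀ j → v j ≃ 0#) → HasDim V 0
  trivial-dim V≈0 = (λ ()) , record
    { contained = λ () ; independent = λ _ _ () ; spanning = λ v v∈V → (λ ()) , V≈0 v∈V }

  zero-dim⇒trivial : ∀ {l d} {V : Pred (Vector Carrier l) ℓ} → d ≡ 0 → HasDim V d → ∀ {v} → V v → ∀ j → v j ≃ 0#
  zero-dim⇒trivial refl (_ , basis) {v} v∈V = proj₂ (IsBasis.spanning basis v v∈V)

  hyperplane-dim : ∀ {l} (a : Vector Carrier l) j → ¬ a j ≃ 0# → ∃[ d ] l ≡ suc d × HasDim (Hyperplane a) d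
  hyperplane-dim {l} a j aⱼ≉0 with cut-dim {V = λ _ → ⊤} (λ _ _ _ _ _ → tt) (full-dim l) a
  ... | inj₁ ⊤⊆H = ⊥-elim (aⱼ≉0 (trans (sym (dot-δ a j)) (⊤⊆H {δ j} tt)))
    where
    dot-δ : ∀ {l} (a : Vector Carrier l) j → dot a (δ j) ≃ a j
    dot-δ a Fin.zero    = trans (+-cong (*-identityʳ _) (sum-zero (λ i → zeroʳ (a (Fin.suc i))))) (+-identityʳ _)
    dot-δ a (Fin.suc j) = trans (+-cong (zeroʳ _) (dot-δ (a ∘ Fin.suc) j)) (+-identityˡ _)
  ... | inj₂ (d , l≡ , dim) = d , l≡ , HasDim-resp-≐ (proj₂ , λ p → tt , p) dim

  equidimensional-cut : ∀ {l d} {V : Pred (Vector Carrier l) ℓ} → IsSubspace V → (α : Vector Carrier l) →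
                        HasDim V d → HasDim (V ∩ Hyperplane α) d → V ⊆ Hyperplane α
  equidimensional-cut V-sub α V-dim V∩H-dim with cut-dim V-sub V-dim α
  ... | inj₁ V⊆H = V⊆H
  ... | inj₂ (d′ , refl , dim) = ⊥-elim (ℕ.1+n≢n (dim-unique V∩H-dim dim))

  intersection-isSubspace : ∀ {l n} (a : Fin n → Vector Carrier l) → IsSubspace (Intersection a)
  intersection-isSubspace a v w k p q i = hyperplane-isSubspace (a i) v w k (p i) (q i)

  module _ {l n} (a : Fin n → Vector Carrier l) where

    killed-isSubspace : ∀ is → IsSubspace (Killed a is)
    killed-isSubspace is v w k p q = All.zipWith (λ {i} (r , s) → hyperplane-isSubspace (a i) v w k r s) (p , q)

    -- At most d forms that, together with those selected by ι, cut
    -- out 0, where d is the dimension of the intersection selected by ι.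
    record Completion {k} (ι : Fin k → Fin n) : Set (c ⊔ ℓ) where
      field
        d          : ℕ
        dim        : HasDim (Intersection (a ∘ ι)) d
        extra      : List (Fin n)
        extra≤d    : length extra ℕ.≤ d
        β          : Fin l → Fin n
        increasing : Increasing β
        trivial    : ∀ {v} → Intersection (a ∘ β) v → ∀ j → v j ≃ 0#
        covered    : ∀ i → (∃[ m ] β i ≡ ι m) ⊎ β i ∈ extra

    abstract
      -- Two greedy rounds, through the forms of `ι` and then, on the subspace reached, through all
      -- forms. Every kept form costs one dimension, so at most `l` are kept; they cut out 0, so at
      -- least `l` distinct ones are needed. This is what makes the enumeration have length exactly
      -- `l`.
      complete : (∀ {v} → Intersection a v → ∀ j → v j ≃ 0#) → ∀ {k} (ι : Fin k → Fin n) → Completion ι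
      complete a≈0 {k} ι
        with E₁ , d₁ , dim₁ , eq₁ , kill₁ , sub₁ ← pivots a {V = λ _ → ⊤} (λ _ _ _ _ _ → tt) (full-dim l) (map ι (allFin k))
        with E₂ , d₂ , dim₂ , eq₂ , kill₂ , sub₂ ← pivots a (∩-isSubspace (λ _ _ _ _ _ → tt) (killed-isSubspace E₁)) dim₁ (allFin n)
        with m , m≤ , enum ← enumerate (E₁ ++ E₂)
        = finish m≤ enum
        where
        E₂≤d₁ : length E₂ ℕ.≤ d₁
        E₂≤d₁ = ℕ.≤-trans (ℕ.m≤m+n (length E₂) d₂) (ℕ.≤-reflexive eq₂)

        E≤l : length (E₁ ++ E₂) ℕ.≤ l
        E≤l = ℕ.≤-trans (ℕ.≤-reflexive (List.length-++ E₁)) (ℕ.≤-trans (ℕ.+-monoʳ-≤ (length E₁) E₂≤d₁) (ℕ.≤-reflexive eq₁))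

        E₁⊆ι : ∀ {e} → e ∈ E₁ → ∃[ b ] e ≡ ι b
        E₁⊆ι e∈ with b , _ , eq ← ∈-map⁻ ι (sub₁ e∈) = b , eq

        β-trivial : ∀ {m} (enum : IncreasingEnumeration (E₁ ++ E₂) m) {v} →
                    Intersection (a ∘ IncreasingEnumeration.index enum) v → ∀ j → v j ≃ 0#
        β-trivial enum {v} p = a≈0 (Killed-allFin a (kill₂ ((tt , All.tabulate (killed ∘ ∈-++⁺ˡ)) , All.tabulate (killed ∘ ∈-++⁺ʳ E₁))))
          where
          killed : ∀ {e} → e ∈ E₁ ++ E₂ → Hyperplane (a e) v
          killed e∈ with b , refl ← IncreasingEnumeration.complete enum e∈ = p b

        finish : ∀ {m} → m ℕ.≤ length (E₁ ++ E₂) → IncreasingEnumeration (E₁ ++ E₂) m → Completion ι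
        finish {m} m≤ enum with refl ← ℕ.≤-antisym (ℕ.≤-trans m≤ E≤l) (trivial⇒dim≤ (a ∘ IncreasingEnumeration.index enum) λ p →
          β-trivial enum p) = record
          { d          = d₁
          ; dim        = HasDim-resp-≐ ((λ p b → All.lookup (All.map⁻ (kill₁ p)) (∈-allFin b)) ,
                                       λ p → tt , All.tabulate λ e∈ → let b , eq = E₁⊆ι e∈ in ≡.subst (λ i → Hyperplane (a i) _) (≡.sym eq) (p b)) dim₁
          ; extra      = E₂
          ; extra≤d    = E₂≤d₁
          ; β          = index
          ; increasing = increasing
          ; trivial    = β-trivial enum
          ; covered    = λ i → [ inj₁ ∘ E₁⊆ι , inj₂ ]′ (∈-++⁻ E₁ (sound i))
          }
          where
          open IncreasingEnumeration enum

    -- On the intersection selected by `ι`, the forms in `E` force all forms of `β` to vanish and so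
    -- leave only 0. By `dim-drop` this takes at least as many forms as there are dimensions.
    complement⇒dim≤ : ∀ {k l′ d} (ι : Fin k → Fin n) (E : List (Fin n)) (β : Fin l′ → Fin n) →
                      (∀ {v} → Intersection (a ∘ β) v → ∀ j → v j ≃ 0#) →
                      (∀ i → (∃[ m ] β i ≡ ι m) ⊎ β i ∈ E) → HasDim (Intersection (a ∘ ι)) d → d ℕ.≤ length E
    complement⇒dim≤ ι E β β≈0 covered dim
      with d′ , dim′ , d≤ ← dim-drop a (intersection-isSubspace (a ∘ ι)) dim E
      = ℕ.≤-trans d≤ (ℕ.≤-reflexive (≡.trans (≡.cong (length E ℕ.+_) (zero-dim W≈0 dim′)) (ℕ.+-identityʳ _)))
      where
      killed : ∀ {v} → Intersection (a ∘ ι) v → Killed a E v → ∀ i → (∃[ m ] β i ≡ ι m) ⊎ β i ∈ E → Hyperplane (a (β i)) v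
      killed p q i (inj₁ (m , eq)) = ≡.subst (λ j → Hyperplane (a j) _) (≡.sym eq) (p m)
      killed p q i (inj₂ i∈E)      = All.lookup q i∈E
      W≈0 : ∀ {v} → (Intersection (a ∘ ι) ∩ Killed a E) v → ∀ j → v j ≃ 0#
      W≈0 (p , q) = β≈0 λ i → killed p q i (covered i)

-- The same index tuples over two fields

open ≡ using (_≢_; _≗_; sym; trans; cong; cong₂; subst; subst₂; module ≡-Reasoning)
open import Algebra.Properties.CommutativeMonoid.Sum ℤ.+-0-commutativeMonoid using (sum; sum-cong-≗; ∑-distrib-+)

Trivial : ∀ {c ℓ} (K : CommutativeRing c ℓ) {l k} → (Fin k → Vector (CommutativeRing.Carrier K) l) → Set (c ⊔ ℓ)
Trivial K a = ∀ {v} → Linear.Intersection K a v → ∀ j → CommutativeRing._≈_ K (v j) (CommutativeRing.0# K)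

module _ {c₁ ℓ₁ c₂ ℓ₂} (K₁ : CommutativeRing c₁ ℓ₁) (isField₁ : IsField K₁)
         (K₂ : CommutativeRing c₂ ℓ₂) (isField₂ : IsField K₂) {l n : ℕ}
         (a₁ : Fin n → Vector (CommutativeRing.Carrier K₁) l)
         (a₂ : Fin n → Vector (CommutativeRing.Carrier K₂) l) where

  private
    module L₁ = FieldLinear K₁ isField₁
    module L₂ = FieldLinear K₂ isField₂

  -- A completion in either field bounds the dimension in the other one.
  bases-agree⇒equivalent : Trivial K₁ a₁ →
    (∀ (β : Fin l → Fin n) → Increasing β → Trivial K₁ (a₁ ∘ β) → Trivial K₂ (a₂ ∘ β)) →
    (∀ (β : Fin l → Fin n) → Increasing β → Trivial K₂ (a₂ ∘ β) → Trivial K₁ (a₁ ∘ β)) →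
    CombinatoriallyEquivalent K₁ K₂ a₁ a₂
  bases-agree⇒equivalent a₁≈0 1⇒2 2⇒1 {k} _ ι _ = C₁.d , C₁.dim , subst (Linear.HasDim K₂ _) (ℕ.≤-antisym d₂≤d₁ d₁≤d₂) C₂.dim
    where
    module C₁ = L₁.Completion (L₁.complete a₁ a₁≈0 ι)

    β₁-trivial : Trivial K₂ (a₂ ∘ C₁.β)
    β₁-trivial = 1⇒2 C₁.β C₁.increasing C₁.trivial

    -- That the whole family cuts out 0 over `K₂` is not given; it comes from the `l`-tuple
    -- transferred from `K₁`.
    module C₂ = L₂.Completion (L₂.complete a₂ (λ killed → β₁-trivial (killed ∘ C₁.β)) ι)

    d₂≤d₁ : C₂.d ℕ.≤ C₁.d
    d₂≤d₁ = ℕ.≤-trans (L₂.complement⇒dim≤ a₂ ι C₁.extra C₁.β β₁-trivial C₁.covered C₂.dim) C₁.extra≤d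

    d₁≤d₂ : C₁.d ℕ.≤ C₂.d
    d₁≤d₂ = ℕ.≤-trans (L₁.complement⇒dim≤ a₁ ι C₂.extra C₂.β (2⇒1 C₂.β C₂.increasing C₂.trivial) C₂.covered C₁.dim) C₂.extra≤d

  module _ (equivalent : CombinatoriallyEquivalent K₁ K₂ a₁ a₂) where

    equivalent⇒trivial : (ι : Fin l → Fin n) → Increasing ι → Linear.HasDim K₁ (Linear.Intersection K₁ (a₁ ∘ ι)) 0 → Trivial K₂ (a₂ ∘ ι)
    equivalent⇒trivial ι ι-incr dim = go l refl
      where
      -- The equivalence speaks of nonempty tuples only; for `l = 0` there is no coordinate to
      -- check.
      go : ∀ m → m ≡ l → Trivial K₂ (a₂ ∘ ι)
      go zero    refl _ ()
      go (suc m) refl killed =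
        let d , dim₁ , dim₂ = equivalent (s≤s z≤n) ι ι-incr in
        L₂.zero-dim⇒trivial (L₁.dim-unique dim₁ dim) dim₂ killed

    -- If H_i′ ⊆ H_i over K₂, then H_i′ and H_i ∩ H_i′ have equal dimensions
    -- over K₂, hence also over K₁.
    equivalent⇒≐ : ∀ {i i′} → i Fin.< i′ →
      ∃[ j ] ¬ CommutativeRing._≈_ K₁ (a₁ i j) (CommutativeRing.0# K₁) →
      ∃[ j ] ¬ CommutativeRing._≈_ K₁ (a₁ i′ j) (CommutativeRing.0# K₁) →
      Linear.Hyperplane K₂ (a₂ i′) ⊆ Linear.Hyperplane K₂ (a₂ i) →
      Linear.Hyperplane K₁ (a₁ i) ≐ Linear.Hyperplane K₁ (a₁ i′)
    equivalent⇒≐ {i} {i′} i<i′ (j , aᵢ≉0) (j′ , aᵢ′≉0) H₂⊆ = (λ {v} → Hᵢ⊆Hᵢ′ {v}) , λ {v} → Hᵢ′⊆Hᵢ {v}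
      where
      open Linear K₁ using (Hyperplane; HasDim)

      single : Fin 1 → Fin n
      single _ = i′

      single-incr : Increasing single
      single-incr {Fin.zero} {Fin.zero} ()

      pair : Fin 2 → Fin n
      pair Fin.zero    = i
      pair (Fin.suc _) = i′

      pair-incr : Increasing pair
      pair-incr {Fin.zero}         {Fin.suc Fin.zero} _ = i<i′
      pair-incr {Fin.suc Fin.zero} {Fin.suc Fin.zero} (s≤s ())

      pair₂≐single₂ : Linear.Intersection K₂ (a₂ ∘ pair) ≐ Linear.Intersection K₂ (a₂ ∘ single)
      pair₂≐single₂ = (λ { q Fin.zero → q (Fin.suc Fin.zero) }) ,
                      λ { q Fin.zero → H₂⊆ (q Fin.zero) ; q (Fin.suc Fin.zero) → q Fin.zero }

      pair₁≐ : Linear.Intersection K₁ (a₁ ∘ pair) ≐ (Hyperplane (a₁ i′) ∩ Hyperplane (a₁ i))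
      pair₁≐ = (λ q → q (Fin.suc Fin.zero) , q Fin.zero) ,
               λ { (q′ , q) Fin.zero → q ; (q′ , q) (Fin.suc Fin.zero) → q′ }

      Hᵢ′⊆Hᵢ : Hyperplane (a₁ i′) ⊆ Hyperplane (a₁ i)
      Hᵢ′⊆Hᵢ =
        let d , dim₁ , dim₂ = equivalent (s≤s z≤n) single (λ {x} {y} → single-incr {x} {y})
            e , dim₁′ , dim₂′ = equivalent (s≤s z≤n) pair (λ {x} {y} → pair-incr {x} {y})
        in L₁.equidimensional-cut (L₁.hyperplane-isSubspace (a₁ i′)) (a₁ i)
             (L₁.HasDim-resp-≐ ((λ q → q Fin.zero) , λ q _ → q) dim₁)
             (subst (HasDim _) (L₂.dim-unique (L₂.HasDim-resp-≐ pair₂≐single₂ dim₂′) dim₂) (L₁.HasDim-resp-≐ pair₁≐ dim₁′))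

      -- Both hyperplanes have dimension `l - 1`, since each form has a nonzero coefficient, so the
      -- inclusion found above is an equality.
      Hᵢ⊆Hᵢ′ : Hyperplane (a₁ i) ⊆ Hyperplane (a₁ i′)
      Hᵢ⊆Hᵢ′ =
        let d , l≡ , dim = L₁.hyperplane-dim (a₁ i) j aᵢ≉0
            d′ , l≡′ , dim′ = L₁.hyperplane-dim (a₁ i′) j′ aᵢ′≉0
        in L₁.equidimensional-cut (L₁.hyperplane-isSubspace (a₁ i)) (a₁ i′) dim
             (subst (HasDim _) (ℕ.suc-injective (trans (sym l≡′) l≡)) (L₁.HasDim-resp-≐ ((λ q → Hᵢ′⊆Hᵢ q , q) , proj₂) dim′))

-- Integer vectors, elimination without division, and gcds

dotℤ : ∀ {l} → Vector ℤ l → Vector ℤ l → ℤ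
dotℤ a v = sum (λ j → a j ℤ.* v j)

dotℤ-scaleʳ : ∀ {l} u (a v : Vector ℤ l) → dotℤ a (λ j → u ℤ.* v j) ≡ u ℤ.* dotℤ a v
dotℤ-scaleʳ {zero}  u a v = sym (ℤ.*-zeroʳ u)
dotℤ-scaleʳ {suc l} u a v =
  trans (cong (λ z → a Fin.zero ℤ.* (u ℤ.* v Fin.zero) ℤ.+ z) (dotℤ-scaleʳ u (Vector.tail a) (Vector.tail v)))
        (lemma u (a Fin.zero) (v Fin.zero) (dotℤ (Vector.tail a) (Vector.tail v)))
  where lemma : ∀ u x y z → x ℤ.* (u ℤ.* y) ℤ.+ u ℤ.* z ≡ u ℤ.* (x ℤ.* y ℤ.+ z)
        lemma = ℤ-Solver.solve-∀

dotℤ-combineˡ : ∀ {l} u c (x y v : Vector ℤ l) →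
                dotℤ (λ j → u ℤ.* x j ℤ.- c ℤ.* y j) v ≡ u ℤ.* dotℤ x v ℤ.- c ℤ.* dotℤ y v
dotℤ-combineˡ {zero}  u c x y v = lemma u c
  where lemma : ∀ u c → 0ℤ ≡ u ℤ.* 0ℤ ℤ.- c ℤ.* 0ℤ
        lemma = ℤ-Solver.solve-∀
dotℤ-combineˡ {suc l} u c x y v =
  trans (cong (λ z → (u ℤ.* x Fin.zero ℤ.- c ℤ.* y Fin.zero) ℤ.* v Fin.zero ℤ.+ z) (dotℤ-combineˡ u c (Vector.tail x) (Vector.tail y) (Vector.tail v)))
        (lemma u c (x Fin.zero) (y Fin.zero) (v Fin.zero) (dotℤ (Vector.tail x) (Vector.tail v)) (dotℤ (Vector.tail y) (Vector.tail v)))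
  where lemma : ∀ u c x y v s t → (u ℤ.* x ℤ.- c ℤ.* y) ℤ.* v ℤ.+ (u ℤ.* s ℤ.- c ℤ.* t) ≡
                                  u ℤ.* (x ℤ.* v ℤ.+ s) ℤ.- c ℤ.* (y ℤ.* v ℤ.+ t)
        lemma = ℤ-Solver.solve-∀

∣-sum : ∀ {l p} {f : Vector ℤ l} → (∀ j → p ∣ f j) → p ∣ sum f
∣-sum {zero}  {p} _   = divides 0ℤ refl
∣-sum {suc l} p∣f = ∣m∣n⇒∣m+n (p∣f Fin.zero) (∣-sum (p∣f ∘ Fin.suc))

scaledUnit : ∀ {l} → ℤ → Fin l → Vector ℤ l
scaledUnit D Fin.zero    Fin.zero    = D
scaledUnit D Fin.zero    (Fin.suc j) = 0ℤ
scaledUnit D (Fin.suc i) Fin.zero    = 0ℤ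
scaledUnit D (Fin.suc i) (Fin.suc j) = scaledUnit D i j

scaledUnit-* : ∀ {l} u D (i j : Fin l) → u ℤ.* scaledUnit D i j ≡ scaledUnit (D ℤ.* u) i j
scaledUnit-* u D Fin.zero    Fin.zero    = ℤ.*-comm u D
scaledUnit-* u D Fin.zero    (Fin.suc j) = ℤ.*-zeroʳ u
scaledUnit-* u D (Fin.suc i) Fin.zero    = ℤ.*-zeroʳ u
scaledUnit-* u D (Fin.suc i) (Fin.suc j) = scaledUnit-* u D i j

-- Being an integer combination of given rows is expressed as lying in every submodule that contains
-- them. No coefficients have to be carried along, and one elimination serves both ideals of
-- polynomials and annihilators of rational vectors.
record IsSubmodule {l} (P : Pred (Vector ℤ l) 0ℓ) : Set where
  field
    ≗-closed : ∀ {v w} → v ≗ w → P v → P w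
    0-closed : P (λ _ → 0ℤ)
    +-closed : ∀ {v w} → P v → P w → P (λ j → v j ℤ.+ w j)
    *-closed : ∀ k {v} → P v → P (λ j → k ℤ.* v j)

drop-coordinate : ∀ {l} {P : Pred (Vector ℤ (suc l)) 0ℓ} → IsSubmodule P → IsSubmodule (λ v → P (0ℤ Vector.∷ v))
drop-coordinate sub = record
  { ≗-closed  = λ v≗w → ≗-closed λ { Fin.zero → refl ; (Fin.suc j) → v≗w j }
  ; 0-closed   = ≗-closed (λ { Fin.zero → refl ; (Fin.suc j) → refl }) 0-closed
  ; +-closed   = λ p q → ≗-closed (λ { Fin.zero → refl ; (Fin.suc j) → refl }) (+-closed p q)
  ; *-closed = λ k p → ≗-closed (λ { Fin.zero → ℤ.*-zeroʳ k ; (Fin.suc j) → refl }) (*-closed k p)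
  } where
  open IsSubmodule sub

units-span : ∀ {l D} {P : Pred (Vector ℤ l) 0ℓ} → IsSubmodule P → (∀ i → P (scaledUnit D i)) →
             ∀ (x : Vector ℤ l) → P (λ j → D ℤ.* x j)
units-span {zero}  {D} sub units x = ≗-closed {w = λ j → D ℤ.* x j} (λ ()) 0-closed
  where
  open IsSubmodule sub
units-span {suc l} {D} {P} sub units x =
  ≗-closed {w = λ j → D ℤ.* x j}
           (λ { Fin.zero → lemma₁ D (x Fin.zero) ; (Fin.suc j) → lemma₂ D (x Fin.zero) (x (Fin.suc j)) })
           (+-closed {w = 0ℤ Vector.∷ λ j → D ℤ.* x (Fin.suc j)} (*-closed (x Fin.zero) (units Fin.zero))
             (units-span {P = λ v → P (0ℤ Vector.∷ v)} (drop-coordinate sub)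
               (λ i → ≗-closed (λ { Fin.zero → refl ; (Fin.suc j) → refl }) (units (Fin.suc i))) (Vector.tail x)))
  where
  open IsSubmodule sub
  lemma₁ : ∀ D x → x ℤ.* D ℤ.+ 0ℤ ≡ D ℤ.* x
  lemma₁ = ℤ-Solver.solve-∀
  lemma₂ : ∀ D x y → x ℤ.* 0ℤ ℤ.+ D ℤ.* y ≡ D ℤ.* y
  lemma₂ = ℤ-Solver.solve-∀

-- Fraction-free elimination.  Allowing p = 0, for which divisibility by p
-- means being 0, covers the rational kernel as well as the kernels mod a prime.
module _ (p : ℕ) (p∤1 : ¬ + p ∣ + 1) (euclid : ∀ x y → + p ∣ x ℤ.* y → + p ∣ x ⊎ + p ∣ y) where

  eliminate : ∀ {l k} (a : Fin k → Vector ℤ l) →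
              (∀ v → (∀ i → + p ∣ dotℤ (a i) v) → ∀ j → + p ∣ v j) →
              ∃[ D ] ¬ + p ∣ D × (∀ {P} → IsSubmodule P → (∀ i → P (a i)) → ∀ j → P (scaledUnit D j))
  eliminate {zero}  a ker = + 1 , p∤1 , λ _ _ ()
  eliminate {suc l} a ker with all? (λ i → + p ∣? a i Fin.zero)
  ... | yes p∣a₀ = ⊥-elim (p∤1 (ker (scaledUnit (+ 1) Fin.zero) killed Fin.zero))
    where
    killed : ∀ i → + p ∣ dotℤ (a i) (scaledUnit (+ 1) Fin.zero)
    killed i = ∣m∣n⇒∣m+n (∣m⇒∣m*n (+ 1) (p∣a₀ i)) (∣-sum (λ j → ∣n⇒∣m*n (a i (Fin.suc j)) (divides 0ℤ refl)))
  -- A pivot exists, as otherwise the first unit vector would lie in the kernel. The pivots become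
  -- the factors of `D`, and `euclid` keeps the product not divisible by `p`.
  ... | no ¬p∣a₀ with i₀ , p∤u ← ¬∀⟶∃¬ _ _ (λ i → + p ∣? a i Fin.zero) ¬p∣a₀ = D′ ℤ.* u , p∤D′u , span
    where
    u = a i₀ Fin.zero

    -- The pivot row stays in the list and becomes 0, so the rows need no reindexing.
    a′ : Fin _ → Vector ℤ l
    a′ j m = u ℤ.* a j (Fin.suc m) ℤ.- a j Fin.zero ℤ.* a i₀ (Fin.suc m)

    ker′ : ∀ v → (∀ j → + p ∣ dotℤ (a′ j) v) → ∀ m → + p ∣ v m
    ker′ v p∣a′v m = [ ⊥-elim ∘ p∤u , id ]′ (euclid u (v m) (ker w p∣aw (Fin.suc m)))
      where
      -- Solving the pivot row for the first coordinate would divide by `u`. Multiplying `v` by `u`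
      -- keeps the lift integral, and `euclid` removes the factor again.
      w = (ℤ.- dotℤ (Vector.tail (a i₀)) v) Vector.∷ λ m → u ℤ.* v m
      lemma : ∀ c t u s → u ℤ.* s ℤ.- c ℤ.* t ≡ c ℤ.* ℤ.- t ℤ.+ u ℤ.* s
      lemma = ℤ-Solver.solve-∀
      p∣aw : ∀ j → + p ∣ dotℤ (a j) w
      p∣aw j = subst (+ p ∣_) (begin
        dotℤ (a′ j) v                                                        ≡⟨ dotℤ-combineˡ u (a j Fin.zero) (Vector.tail (a j)) (Vector.tail (a i₀)) v ⟩
        u ℤ.* dotℤ (Vector.tail (a j)) v ℤ.- a j Fin.zero ℤ.* dotℤ (Vector.tail (a i₀)) v  ≡⟨ lemma (a j Fin.zero) (dotℤ (Vector.tail (a i₀)) v) u (dotℤ (Vector.tail (a j)) v) ⟩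
        a j Fin.zero ℤ.* w Fin.zero ℤ.+ u ℤ.* dotℤ (Vector.tail (a j)) v            ≡⟨ cong (λ z → a j Fin.zero ℤ.* w Fin.zero ℤ.+ z) (sym (dotℤ-scaleʳ u (Vector.tail (a j)) v)) ⟩
        dotℤ (a j) w                                                         ∎) (p∣a′v j)
        where
        open ≡-Reasoning

    rec = eliminate a′ ker′
    D′ = let D , _ = rec in D

    p∤D′u : ¬ + p ∣ D′ ℤ.* u
    p∤D′u p∣D′u = [ (let _ , p∤D′ , _ = rec in p∤D′) , p∤u ]′ (euclid D′ u p∣D′u)

    span : ∀ {P} → IsSubmodule P → (∀ i → P (a i)) → ∀ j → P (scaledUnit (D′ ℤ.* u) j)
    span {P} sub rows = λ where
        -- From `D′` times the pivot row its tail is subtracted, which `units-span` builds from the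
        -- `D′`-multiples of the other unit vectors; `D′ u` remains in the first coordinate.
        Fin.zero    → ≗-closed (λ { Fin.zero → lemma₁ D′ u ; (Fin.suc m) → lemma₂ D′ (a i₀ (Fin.suc m)) })
                           (+-closed (*-closed D′ (rows i₀))
                                (*-closed (ℤ.- + 1) {v = 0ℤ Vector.∷ λ j → D′ ℤ.* a i₀ (Fin.suc j)} (units-span {P = λ v → P (0ℤ Vector.∷ v)} (drop-coordinate sub) units′ (Vector.tail (a i₀)))))
        (Fin.suc m) → ≗-closed (λ { Fin.zero → ℤ.*-zeroʳ u ; (Fin.suc j) → scaledUnit-* u D′ m j }) (*-closed u (units′ m))
      where
      open IsSubmodule sub
      lemma₁ : ∀ D u → D ℤ.* u ℤ.+ ℤ.- + 1 ℤ.* 0ℤ ≡ D ℤ.* u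
      lemma₁ = ℤ-Solver.solve-∀
      lemma₂ : ∀ D x → D ℤ.* x ℤ.+ ℤ.- + 1 ℤ.* (D ℤ.* x) ≡ 0ℤ
      lemma₂ = ℤ-Solver.solve-∀
      lemma₃ : ∀ u c → u ℤ.* c ℤ.+ ℤ.- c ℤ.* u ≡ 0ℤ
      lemma₃ = ℤ-Solver.solve-∀
      lemma₄ : ∀ u c x y → u ℤ.* x ℤ.+ ℤ.- c ℤ.* y ≡ u ℤ.* x ℤ.- c ℤ.* y
      lemma₄ = ℤ-Solver.solve-∀
      units′ : ∀ m → P (0ℤ Vector.∷ scaledUnit D′ m)
      units′ = let _ , _ , span′ = rec in span′ (drop-coordinate sub) λ j →
        ≗-closed (λ { Fin.zero    → lemma₃ u (a j Fin.zero)
                ; (Fin.suc m) → lemma₄ u (a j Fin.zero) (a j (Fin.suc m)) (a i₀ (Fin.suc m)) })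
             (+-closed (*-closed u (rows j)) (*-closed (ℤ.- a j Fin.zero) (rows i₀)))

bezout : ∀ c D → ∃ λ (d : ℕ) → (∃₂ λ u v → u ℤ.* c ℤ.+ v ℤ.* D ≡ + d) × + d ∣ c × + d ∣ D
bezout c D = d , identity , ℤ.∣ᵤ⇒∣ (gcd[m,n]∣m ℤ.∣ c ∣ ℤ.∣ D ∣) , ℤ.∣ᵤ⇒∣ (gcd[m,n]∣n ℤ.∣ c ∣ ℤ.∣ D ∣)
  where
  d = gcd ℤ.∣ c ∣ ℤ.∣ D ∣
  -- `ε` and `η` act as signs: they carry the identity between the natural numbers `|c|` and `|D|`
  -- over to `c` and `D`.
  open _∣_ (ℤ.m∣∣m∣ {c}) renaming (quotient to ε; equality to ∣c∣≡εc)
  open _∣_ (ℤ.m∣∣m∣ {D}) renaming (quotient to η; equality to ∣D∣≡ηD)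
  open ≡-Reasoning

  cast : ∀ a m b n → a ℕ.+ m ℕ.* ℤ.∣ b ∣ ≡ n → + a ℤ.+ + m ℤ.* + ℤ.∣ b ∣ ≡ + n
  cast a m b n eq = trans (cong (λ z → + a ℤ.+ z) (sym (ℤ.pos-* m ℤ.∣ b ∣))) (trans (sym (ℤ.pos-+ a _)) (cong +_ eq))

  identity : ∃₂ λ u v → u ℤ.* c ℤ.+ v ℤ.* D ≡ + d
  identity with Bézout.identity (gcd-GCD ℤ.∣ c ∣ ℤ.∣ D ∣)
  ... | Bézout.+- x y eq = + x ℤ.* ε , ℤ.- (+ y ℤ.* η) , (begin
    + x ℤ.* ε ℤ.* c ℤ.+ ℤ.- (+ y ℤ.* η) ℤ.* D         ≡⟨ lemma₁ (+ x) ε c (+ y) η D ⟩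
    + x ℤ.* (ε ℤ.* c) ℤ.- + y ℤ.* (η ℤ.* D)           ≡⟨ cong₂ (λ m n → + x ℤ.* m ℤ.- + y ℤ.* n) (sym ∣c∣≡εc) (sym ∣D∣≡ηD) ⟩
    + x ℤ.* + ℤ.∣ c ∣ ℤ.- + y ℤ.* + ℤ.∣ D ∣           ≡⟨ cong (ℤ._- + y ℤ.* + ℤ.∣ D ∣) (trans (sym (ℤ.pos-* x ℤ.∣ c ∣)) (sym (cast d y D _ eq))) ⟩
    + d ℤ.+ + y ℤ.* + ℤ.∣ D ∣ ℤ.- + y ℤ.* + ℤ.∣ D ∣   ≡⟨ lemma₂ (+ d) (+ y ℤ.* + ℤ.∣ D ∣) ⟩
    + d                                               ∎)
    where
    lemma₁ : ∀ x ε c y η D → x ℤ.* ε ℤ.* c ℤ.+ ℤ.- (y ℤ.* η) ℤ.* D ≡ x ℤ.* (ε ℤ.* c) ℤ.- y ℤ.* (η ℤ.* D)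
    lemma₁ = ℤ-Solver.solve-∀
    lemma₂ : ∀ d z → d ℤ.+ z ℤ.- z ≡ d
    lemma₂ = ℤ-Solver.solve-∀
  ... | Bézout.-+ x y eq = ℤ.- (+ x ℤ.* ε) , + y ℤ.* η , (begin
    ℤ.- (+ x ℤ.* ε) ℤ.* c ℤ.+ + y ℤ.* η ℤ.* D         ≡⟨ lemma₁ (+ x) ε c (+ y) η D ⟩
    + y ℤ.* (η ℤ.* D) ℤ.- + x ℤ.* (ε ℤ.* c)           ≡⟨ cong₂ (λ m n → + y ℤ.* n ℤ.- + x ℤ.* m) (sym ∣c∣≡εc) (sym ∣D∣≡ηD) ⟩
    + y ℤ.* + ℤ.∣ D ∣ ℤ.- + x ℤ.* + ℤ.∣ c ∣           ≡⟨ cong (ℤ._- + x ℤ.* + ℤ.∣ c ∣) (trans (sym (ℤ.pos-* y ℤ.∣ D ∣)) (sym (cast d x c _ eq))) ⟩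
    + d ℤ.+ + x ℤ.* + ℤ.∣ c ∣ ℤ.- + x ℤ.* + ℤ.∣ c ∣   ≡⟨ lemma₂ (+ d) (+ x ℤ.* + ℤ.∣ c ∣) ⟩
    + d                                               ∎)
    where
    lemma₁ : ∀ x ε c y η D → ℤ.- (x ℤ.* ε) ℤ.* c ℤ.+ y ℤ.* η ℤ.* D ≡ y ℤ.* (η ℤ.* D) ℤ.- x ℤ.* (ε ℤ.* c)
    lemma₁ = ℤ-Solver.solve-∀
    lemma₂ : ∀ d z → d ℤ.+ z ℤ.- z ≡ d
    lemma₂ = ℤ-Solver.solve-∀

-- Terms

infix 4 _≟ᵗ_
_≟ᵗ_ : ∀ {l} (s t : Term l) → Dec (s ≡ t)
_≟ᵗ_ = Vec.≡-dec ℕ._≟_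

·-comm : ∀ {l} (s t : Term l) → s · t ≡ t · s
·-comm = Vec.zipWith-comm ℕ.+-comm

·-assoc : ∀ {l} (s t u : Term l) → (s · t) · u ≡ s · (t · u)
·-assoc = Vec.zipWith-assoc ℕ.+-assoc

·-identityˡ : ∀ {l} (t : Term l) → 𝟏 · t ≡ t
·-identityˡ = Vec.zipWith-identityˡ ℕ.+-identityˡ

·-cancelˡ : ∀ {l} (s : Term l) {t u} → s · t ≡ s · u → t ≡ u
·-cancelˡ []      {[]}    {[]}    _  = refl
·-cancelˡ (m ∷ s) {n ∷ t} {k ∷ u} eq with m+n≡m+k , st≡su ← Vec.∷-injective eq =
  cong₂ _∷_ (ℕ.+-cancelˡ-≡ m n k m+n≡m+k) (·-cancelˡ s st≡su)

infix 4 _∣ᵗ_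
_∣ᵗ_ : ∀ {l} → Term l → Term l → Set
s ∣ᵗ t = ∃[ u ] t ≡ u · s

factor? : ∀ {l} (s t : Term l) → Dec (∃[ u ] t ≡ s · u)
factor? []      []      = yes ([] , refl)
factor? (m ∷ s) (n ∷ t) with m ℕ.≤? n | factor? s t
... | yes m≤n | yes (u , refl) = yes (n ℕ.∸ m ∷ u , cong (_∷ _) (sym (ℕ.m+[n∸m]≡n m≤n)))
... | no m≰n  | _              = no λ { (k ∷ u , eq) → m≰n (subst (m ℕ.≤_) (sym (Vec.∷-injectiveˡ eq)) (ℕ.m≤m+n m k)) }
... | _       | no ¬s∣t        = no λ { (k ∷ u , eq) → ¬s∣t (u , Vec.∷-injectiveʳ eq) }

𝟏-factor : ∀ {l} {s t : Term l} → s · t ≡ 𝟏 → s ≡ 𝟏 × t ≡ 𝟏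
𝟏-factor {s = []}       {[]}       _  = refl , refl
𝟏-factor {s = zero ∷ s} {zero ∷ t} eq with s≡𝟏 , t≡𝟏 ← 𝟏-factor {s = s} {t} (Vec.∷-injectiveʳ eq) =
  cong (0 ∷_) s≡𝟏 , cong (0 ∷_) t≡𝟏

var-factor : ∀ {l} {s t : Term l} j → s · t ≡ var j → s ≡ 𝟏 ⊎ t ≡ 𝟏
var-factor {s = m ∷ s} {n ∷ t} Fin.zero eq with s≡𝟏 , t≡𝟏 ← 𝟏-factor {s = s} {t} (Vec.∷-injectiveʳ eq) with m | n | Vec.∷-injectiveˡ eq
... | zero        | _    | _ = inj₁ (cong (0 ∷_) s≡𝟏)
... | suc zero    | zero | _ = inj₂ (cong (0 ∷_) t≡𝟏)
var-factor {s = zero ∷ s} {zero ∷ t} (Fin.suc j) eq with var-factor {s = s} {t} j (Vec.∷-injectiveʳ eq)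
... | inj₁ s≡𝟏 = inj₁ (cong (0 ∷_) s≡𝟏)
... | inj₂ t≡𝟏 = inj₂ (cong (0 ∷_) t≡𝟏)

var≢𝟏 : ∀ {l} (j : Fin l) → var j ≢ 𝟏
var≢𝟏 Fin.zero    ()
var≢𝟏 (Fin.suc j) eq = var≢𝟏 j (Vec.∷-injectiveʳ eq)

var-injective : ∀ {l} {i j : Fin l} → var i ≡ var j → i ≡ j
var-injective {i = Fin.zero}  {Fin.zero}  _  = refl
var-injective {i = Fin.suc i} {Fin.suc j} eq = cong Fin.suc (var-injective (Vec.∷-injectiveʳ eq))

var-divides : ∀ {l} {t : Term l} → t ≢ 𝟏 → ∃[ j ] var j ∣ᵗ t
var-divides {t = []}        t≢𝟏 = ⊥-elim (t≢𝟏 refl)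
var-divides {t = zero ∷ t}  t≢𝟏 with j , u , eq ← var-divides {t = t} (t≢𝟏 ∘ cong (0 ∷_)) = Fin.suc j , 0 ∷ u , cong (0 ∷_) eq
var-divides {t = suc n ∷ t} t≢𝟏 = Fin.zero , n ∷ t ,
  cong₂ _∷_ (sym (ℕ.+-comm n 1)) (sym (trans (·-comm t 𝟏) (·-identityˡ t)))

-- Coefficients

module _ {l : ℕ} where

  coeff-here : ∀ c (t : Term l) f → coeff ((c , t) ∷ f) t ≡ c ℤ.+ coeff f t
  coeff-here c t f with t ≟ᵗ t
  ... | yes _  = refl
  ... | no t≢t = ⊥-elim (t≢t refl)

  coeff-skip : ∀ c {s t : Term l} f → s ≢ t → coeff ((c , s) ∷ f) t ≡ coeff f t
  coeff-skip c {s} {t} f s≢t with s ≟ᵗ t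
  ... | yes s≡t = ⊥-elim (s≢t s≡t)
  ... | no _    = ℤ.+-identityˡ _

  coeff-++ : ∀ (f g : Poly l) t → coeff (f ++ g) t ≡ coeff f t ℤ.+ coeff g t
  coeff-++ []            g t = sym (ℤ.+-identityˡ _)
  coeff-++ ((c , s) ∷ f) g t with s ≟ᵗ t
  ... | yes _ = trans (cong (ℤ._+_ c) (coeff-++ f g t)) (sym (ℤ.+-assoc c (coeff f t) (coeff g t)))
  ... | no _  = trans (cong (ℤ._+_ 0ℤ) (coeff-++ f g t)) (sym (ℤ.+-assoc 0ℤ (coeff f t) (coeff g t)))

  coeff≢0⇒∈ : ∀ (f : Poly l) {t} → coeff f t ≢ 0ℤ → t ∈ map proj₂ f
  coeff≢0⇒∈ []            f≢0 = ⊥-elim (f≢0 refl)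
  coeff≢0⇒∈ ((c , s) ∷ f) {t} f≢0 with s ≟ᵗ t
  ... | yes refl = here refl
  ... | no s≢t   = there (coeff≢0⇒∈ f (f≢0 ∘ trans (ℤ.+-identityˡ _)))

  -- Multiplication by one monomial. A product `h *ₚ f` is a concatenation of such multiples, so
  -- closure of ideals only has to be checked for them.
  scaleₚ : ℤ → Term l → Poly l → Poly l
  scaleₚ a s = map (λ (b , t) → a ℤ.* b , s · t)

  coeff-scale : ∀ a s (f : Poly l) t → coeff (scaleₚ a s f) (s · t) ≡ a ℤ.* coeff f t
  coeff-scale a s []            t = sym (ℤ.*-zeroʳ a)
  coeff-scale a s ((b , u) ∷ f) t = case-≟ (u ≟ᵗ t)
    where
    open ≡-Reasoning
    case-≟ : Dec (u ≡ t) → coeff (scaleₚ a s ((b , u) ∷ f)) (s · t) ≡ a ℤ.* coeff ((b , u) ∷ f) t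
    case-≟ (yes refl) = begin
      coeff ((a ℤ.* b , s · u) ∷ scaleₚ a s f) (s · u)  ≡⟨ coeff-here (a ℤ.* b) (s · u) (scaleₚ a s f) ⟩
      a ℤ.* b ℤ.+ coeff (scaleₚ a s f) (s · u)          ≡⟨ cong (λ z → a ℤ.* b ℤ.+ z) (coeff-scale a s f u) ⟩
      a ℤ.* b ℤ.+ a ℤ.* coeff f u                       ≡⟨ ℤ.*-distribˡ-+ a b (coeff f u) ⟨
      a ℤ.* (b ℤ.+ coeff f u)                           ≡⟨ cong (ℤ._*_ a) (coeff-here b u f) ⟨
      a ℤ.* coeff ((b , u) ∷ f) u                       ∎
    case-≟ (no u≢t) = begin
      coeff ((a ℤ.* b , s · u) ∷ scaleₚ a s f) (s · t)  ≡⟨ coeff-skip (a ℤ.* b) (scaleₚ a s f) (u≢t ∘ ·-cancelˡ s) ⟩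
      coeff (scaleₚ a s f) (s · t)                      ≡⟨ coeff-scale a s f t ⟩
      a ℤ.* coeff f t                                   ≡⟨ cong (ℤ._*_ a) (coeff-skip b f u≢t) ⟨
      a ℤ.* coeff ((b , u) ∷ f) t                       ∎

  coeff-scale-∤ : ∀ a s (f : Poly l) {t} → ¬ (∃[ u ] t ≡ s · u) → coeff (scaleₚ a s f) t ≡ 0ℤ
  coeff-scale-∤ a s []            ¬s∣t = refl
  coeff-scale-∤ a s ((b , u) ∷ f) ¬s∣t =
    trans (coeff-skip (a ℤ.* b) (scaleₚ a s f) (λ su≡t → ¬s∣t (u , sym su≡t))) (coeff-scale-∤ a s f ¬s∣t)

  coeff-scale-𝟏 : ∀ a (f : Poly l) t → coeff (scaleₚ a 𝟏 f) t ≡ a ℤ.* coeff f t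
  coeff-scale-𝟏 a f t = subst (λ u → coeff (scaleₚ a 𝟏 f) u ≡ a ℤ.* coeff f t) (·-identityˡ t) (coeff-scale a 𝟏 f t)

  scale-cong : ∀ a s {f g : Poly l} → f ≈ g → scaleₚ a s f ≈ scaleₚ a s g
  scale-cong a s {f} {g} f≈g t with factor? s t
  ... | yes (u , refl) = trans (coeff-scale a s f u) (trans (cong (ℤ._*_ a) (f≈g u)) (sym (coeff-scale a s g u)))
  ... | no ¬s∣t        = trans (coeff-scale-∤ a s f ¬s∣t) (sym (coeff-scale-∤ a s g ¬s∣t))

-- Ideals

  record IsIdeal (J : Pred (Poly l) 0ℓ) : Set where
    field
      ≈-closed : ∀ {f g} → f ≈ g → J f → J g
      0-closed : J []
      +-closed : ∀ {f g} → J f → J g → J (f ++ g)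
      *-closed : ∀ a s {f} → J f → J (scaleₚ a s f)

  *ₚ-closed : ∀ {J} → IsIdeal J → ∀ h {f} → J f → J (h *ₚ f)
  *ₚ-closed ideal []            f∈J = IsIdeal.0-closed ideal
  *ₚ-closed ideal ((a , s) ∷ h) f∈J = IsIdeal.+-closed ideal (IsIdeal.*-closed ideal a s f∈J) (*ₚ-closed ideal h f∈J)

  sumₚ-closed : ∀ {J} → IsIdeal J → ∀ {k} {H : Fin k → Poly l} → (∀ i → J (H i)) → J (sumₚ H)
  sumₚ-closed ideal {zero}  H∈J = IsIdeal.0-closed ideal
  sumₚ-closed ideal {suc k} H∈J = IsIdeal.+-closed ideal (H∈J Fin.zero) (sumₚ-closed ideal (H∈J ∘ Fin.suc))

  ⟨⟩-least : ∀ {J} → IsIdeal J → ∀ {k} {F : Fin k → Poly l} → (∀ i → J (F i)) → ∀ {f} → ⟨ F ⟩ f → J f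
  ⟨⟩-least ideal F∈J (h , f≈) =
    IsIdeal.≈-closed ideal (sym ∘ f≈) (sumₚ-closed ideal (λ i → *ₚ-closed ideal (h i) (F∈J i)))

  coeff-sumₚ : ∀ {k} (H : Fin k → Poly l) t → coeff (sumₚ H) t ≡ sum (λ i → coeff (H i) t)
  coeff-sumₚ {zero}  H t = refl
  coeff-sumₚ {suc k} H t = trans (coeff-++ (H Fin.zero) _ t) (cong (ℤ._+_ (coeff (H Fin.zero) t)) (coeff-sumₚ (H ∘ Fin.suc) t))

  *ₚ-distribʳ : ∀ (f g h : Poly l) → (f ++ g) *ₚ h ≡ f *ₚ h ++ g *ₚ h
  *ₚ-distribʳ f g h = List.concatMap-++ _ f g

  scale-assoc : ∀ a s (h f : Poly l) → scaleₚ a s (h *ₚ f) ≡ scaleₚ a s h *ₚ f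
  scale-assoc a s []            f = refl
  scale-assoc a s ((b , t) ∷ h) f = trans (List.map-++ _ (scaleₚ b t f) (h *ₚ f))
    (cong₂ _++_ (trans (sym (List.map-∘ f)) (List.map-cong (λ (c , u) → cong₂ _,_ (sym (ℤ.*-assoc a b c)) (sym (·-assoc s t u))) f))
                (scale-assoc a s h f))

  scale-sumₚ : ∀ a s {k} (H : Fin k → Poly l) → scaleₚ a s (sumₚ H) ≡ sumₚ (scaleₚ a s ∘ H)
  scale-sumₚ a s {zero}  H = refl
  scale-sumₚ a s {suc k} H = trans (List.map-++ _ (H Fin.zero) _) (cong (scaleₚ a s (H Fin.zero) ++_) (scale-sumₚ a s (H ∘ Fin.suc)))

  sumₚ-cong : ∀ {k} {H H′ : Fin k → Poly l} → (∀ i → H i ≈ H′ i) → sumₚ H ≈ sumₚ H′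
  sumₚ-cong {H = H} {H′} H≈H′ t =
    trans (coeff-sumₚ H t) (trans (sum-cong-≗ (λ i → H≈H′ i t)) (sym (coeff-sumₚ H′ t)))

  ≡⇒≈ : ∀ {f g : Poly l} → f ≡ g → f ≈ g
  ≡⇒≈ refl t = refl

  ⟨⟩-isIdeal : ∀ {k} (F : Fin k → Poly l) → IsIdeal ⟨ F ⟩
  ⟨⟩-isIdeal {k} F = record
    { ≈-closed = λ f≈g (h , f≈) → h , λ t → trans (sym (f≈g t)) (f≈ t)
    ; 0-closed = (λ _ → []) , λ t → sym (zero-sum {k} t)
    ; +-closed = λ {f} {g} (h , f≈) (h′ , g≈) → (λ i → h i ++ h′ i) , λ t → begin
        coeff (f ++ g) t                                              ≡⟨ coeff-++ f g t ⟩
        coeff f t ℤ.+ coeff g t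
          ≡⟨ cong₂ ℤ._+_ (trans (f≈ t) (coeff-sumₚ (λ i → h i *ₚ F i) t)) (trans (g≈ t) (coeff-sumₚ (λ i → h′ i *ₚ F i) t)) ⟩
        sum (λ i → coeff (h i *ₚ F i) t) ℤ.+ sum (λ i → coeff (h′ i *ₚ F i) t)
          ≡⟨ ∑-distrib-+ (λ i → coeff (h i *ₚ F i) t) (λ i → coeff (h′ i *ₚ F i) t) ⟨
        sum (λ i → coeff (h i *ₚ F i) t ℤ.+ coeff (h′ i *ₚ F i) t)
          ≡⟨ sum-cong-≗ (λ i → trans (cong (λ q → coeff q t) (*ₚ-distribʳ (h i) (h′ i) (F i))) (coeff-++ (h i *ₚ F i) (h′ i *ₚ F i) t)) ⟨
        sum (λ i → coeff ((h i ++ h′ i) *ₚ F i) t)                    ≡⟨ coeff-sumₚ (λ i → (h i ++ h′ i) *ₚ F i) t ⟨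
        coeff (sumₚ (λ i → (h i ++ h′ i) *ₚ F i)) t                   ∎
    ; *-closed = λ a s {f} (h , f≈) → (λ i → scaleₚ a s (h i)) , λ t → begin
        coeff (scaleₚ a s f) t                             ≡⟨ scale-cong a s {f} {sumₚ (λ i → h i *ₚ F i)} f≈ t ⟩
        coeff (scaleₚ a s (sumₚ (λ i → h i *ₚ F i))) t     ≡⟨ cong (λ q → coeff q t) (scale-sumₚ a s (λ i → h i *ₚ F i)) ⟩
        coeff (sumₚ (λ i → scaleₚ a s (h i *ₚ F i))) t
          ≡⟨ sumₚ-cong {H = λ i → scaleₚ a s (h i *ₚ F i)} (λ i → ≡⇒≈ (scale-assoc a s (h i) (F i))) t ⟩
        coeff (sumₚ (λ i → scaleₚ a s (h i) *ₚ F i)) t     ∎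
    }
    where
    open ≡-Reasoning
    zero-sum : ∀ {k} t → coeff (sumₚ {k = k} (λ _ → [])) t ≡ 0ℤ
    zero-sum {zero}  t = refl
    zero-sum {suc k} t = zero-sum {k} t

  ⟨⟩-generator : ∀ {k} (F : Fin k → Poly l) i → ⟨ F ⟩ (F i)
  ⟨⟩-generator F Fin.zero = (((+ 1 , 𝟏) ∷ []) Vector.∷ λ _ → []) , λ t → sym (begin
    coeff ((scaleₚ (+ 1) 𝟏 (F Fin.zero) ++ []) ++ _) t     ≡⟨ coeff-++ (scaleₚ (+ 1) 𝟏 (F Fin.zero) ++ []) _ t ⟩
    coeff (scaleₚ (+ 1) 𝟏 (F Fin.zero) ++ []) t ℤ.+ _
      ≡⟨ cong₂ ℤ._+_ (trans (cong (λ q → coeff q t) (List.++-identityʳ (scaleₚ (+ 1) 𝟏 (F Fin.zero))))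
                            (trans (coeff-scale-𝟏 (+ 1) (F Fin.zero) t) (ℤ.*-identityˡ _)))
                     (sym (proj₂ (IsIdeal.0-closed (⟨⟩-isIdeal (F ∘ Fin.suc))) t)) ⟩
    coeff (F Fin.zero) t ℤ.+ 0ℤ                            ≡⟨ ℤ.+-identityʳ _ ⟩
    coeff (F Fin.zero) t                                   ∎)
    where
    open ≡-Reasoning
  ⟨⟩-generator F (Fin.suc i) with h , Fi≈ ← ⟨⟩-generator (F ∘ Fin.suc) i = ([] Vector.∷ h) , Fi≈

-- Linear forms

  -- `linearForm` is the case `T = var`. General `T` is what recursion on the number of summands
  -- needs: dropping the first variable leaves the remaining ones as terms in all `l` variables.
  formalSum : ∀ {k} → (Fin k → Term l) → Vector ℤ k → Poly l
  formalSum T a = tabulate (λ j → a j , T j)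

  coeff-∷-+ : ∀ a b (s t : Term l) f g h → coeff h t ≡ coeff f t ℤ.+ coeff g t →
              coeff ((a ℤ.+ b , s) ∷ h) t ≡ coeff ((a , s) ∷ f) t ℤ.+ coeff ((b , s) ∷ g) t
  coeff-∷-+ a b s t f g h eq with s ≟ᵗ t
  ... | yes _ = trans (cong (λ z → a ℤ.+ b ℤ.+ z) eq) (lemma a b (coeff f t) (coeff g t))
    where lemma : ∀ a b x y → a ℤ.+ b ℤ.+ (x ℤ.+ y) ≡ a ℤ.+ x ℤ.+ (b ℤ.+ y)
          lemma = ℤ-Solver.solve-∀
  ... | no _  = trans (ℤ.+-identityˡ _) (trans eq (sym (cong₂ ℤ._+_ (ℤ.+-identityˡ (coeff f t)) (ℤ.+-identityˡ (coeff g t)))))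

  formalSum-+ : ∀ {k} (T : Fin k → Term l) v w → formalSum T (λ j → v j ℤ.+ w j) ≈ formalSum T v ++ formalSum T w
  formalSum-+ T v w t = trans (go T v w) (sym (coeff-++ (formalSum T v) (formalSum T w) t))
    where
    go : ∀ {k} (T : Fin k → Term l) v w → coeff (formalSum T (λ j → v j ℤ.+ w j)) t ≡ coeff (formalSum T v) t ℤ.+ coeff (formalSum T w) t
    go {zero}  T v w = refl
    go {suc k} T v w = coeff-∷-+ (v Fin.zero) (w Fin.zero) (T Fin.zero) t
      (formalSum (T ∘ Fin.suc) (v ∘ Fin.suc)) (formalSum (T ∘ Fin.suc) (w ∘ Fin.suc))
      (formalSum (T ∘ Fin.suc) (λ j → v (Fin.suc j) ℤ.+ w (Fin.suc j))) (go (T ∘ Fin.suc) (v ∘ Fin.suc) (w ∘ Fin.suc))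

  formalSum-* : ∀ {k} (T : Fin k → Term l) c v → formalSum T (λ j → c ℤ.* v j) ≡ scaleₚ c 𝟏 (formalSum T v)
  formalSum-* T c v = trans (List.tabulate-cong (λ j → cong (c ℤ.* v j ,_) (sym (·-identityˡ (T j)))))
                            (sym (List.map-tabulate (λ j → v j , T j) _))

  formalSum-0 : ∀ {k} (T : Fin k → Term l) → formalSum T (λ _ → 0ℤ) ≈ []
  formalSum-0 {zero}  T t = refl
  formalSum-0 {suc k} T t with T Fin.zero ≟ᵗ t
  ... | yes _ = trans (ℤ.+-identityˡ _) (formalSum-0 (T ∘ Fin.suc) t)
  ... | no _  = trans (ℤ.+-identityˡ _) (formalSum-0 (T ∘ Fin.suc) t)

  formalSum-unit : ∀ {k} (T : Fin k → Term l) D j → formalSum T (scaledUnit D j) ≈ (D , T j) ∷ []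
  formalSum-unit T D Fin.zero    t with T Fin.zero ≟ᵗ t
  ... | yes _ = cong (ℤ._+_ D) (formalSum-0 (T ∘ Fin.suc) t)
  ... | no _  = cong (ℤ._+_ 0ℤ) (formalSum-0 (T ∘ Fin.suc) t)
  formalSum-unit T D (Fin.suc j) t with T Fin.zero ≟ᵗ t
  ... | yes _ = trans (ℤ.+-identityˡ _) (formalSum-unit (T ∘ Fin.suc) D j t)
  ... | no _  = trans (ℤ.+-identityˡ _) (formalSum-unit (T ∘ Fin.suc) D j t)

  coeff-formalSum-∉ : ∀ {k} (T : Fin k → Term l) a {t} → (∀ j → T j ≢ t) → coeff (formalSum T a) t ≡ 0ℤ
  coeff-formalSum-∉ {zero}  T a t∉T = refl
  coeff-formalSum-∉ {suc k} T a t∉T =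
    trans (coeff-skip (a Fin.zero) (formalSum (T ∘ Fin.suc) (a ∘ Fin.suc)) (t∉T Fin.zero)) (coeff-formalSum-∉ (T ∘ Fin.suc) (a ∘ Fin.suc) (t∉T ∘ Fin.suc))

  coeff-formalSum : ∀ {k} (T : Fin k → Term l) a → (∀ {i j} → T i ≡ T j → i ≡ j) → ∀ j → coeff (formalSum T a) (T j) ≡ a j
  coeff-formalSum T a inj Fin.zero = trans (coeff-here (a Fin.zero) (T Fin.zero) (formalSum (T ∘ Fin.suc) (a ∘ Fin.suc)))
    (trans (cong (ℤ._+_ (a Fin.zero)) (coeff-formalSum-∉ (T ∘ Fin.suc) (a ∘ Fin.suc) λ j eq → Fin.0≢1+n (sym (inj eq)))) (ℤ.+-identityʳ _))
  coeff-formalSum T a inj (Fin.suc j) = trans (coeff-skip (a Fin.zero) (formalSum (T ∘ Fin.suc) (a ∘ Fin.suc)) (λ eq → Fin.0≢1+n (inj eq)))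
    (coeff-formalSum (T ∘ Fin.suc) (a ∘ Fin.suc) (λ eq → Fin.suc-injective (inj eq)) j)

-- Through this, the multiples of unit vectors found by `eliminate` become elements `D x_j` of the
-- ideal.
linearForm∈-isSubmodule : ∀ {l} {J : Pred (Poly l) 0ℓ} → IsIdeal J → IsSubmodule (J ∘ linearForm)
linearForm∈-isSubmodule {J = J} ideal = record
  { ≗-closed = λ v≗w → subst J (List.tabulate-cong (λ j → cong (_, var j) (v≗w j)))
  ; 0-closed = ≈-closed (sym ∘ formalSum-0 var) 0-closed
  ; +-closed = λ {v} {w} p q → ≈-closed (sym ∘ formalSum-+ var v w) (+-closed p q)
  ; *-closed = λ c {v} p → subst J (sym (formalSum-* var c v)) (*-closed c 𝟏 p)
  } where
  open IsIdeal ideal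

-- The derivative at the origin in a direction v annihilated mod p by the
-- generators of an ideal is divisible by p on the whole ideal.
module _ {l : ℕ} (p : ℤ) (v : Vector ℤ l) where

  Flat : Pred (Poly l) 0ℓ
  Flat f = coeff f 𝟏 ≡ 0ℤ × p ∣ dotℤ (λ j → coeff f (var j)) v

  -- This is the Leibniz rule at the origin: because `f` has no constant coefficient, a multiple of
  -- `f` by a term other than `𝟏` has no linear part at all. That is why `Flat` also asks for the
  -- constant coefficient to vanish.
  flat-isIdeal : IsIdeal Flat
  flat-isIdeal = record
    { ≈-closed = λ f≈g (f₀ , p∣f) → trans (sym (f≈g 𝟏)) f₀ ,
        subst (p ∣_) (sum-cong-≗ (λ j → cong (ℤ._* v j) (f≈g (var j)))) p∣f
    ; 0-closed = refl , ∣-sum {f = λ j → 0ℤ ℤ.* v j} (λ j → divides 0ℤ refl)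
    ; +-closed = λ {f} {g} (f₀ , p∣f) (g₀ , p∣g) → trans (coeff-++ f g 𝟏) (cong₂ ℤ._+_ f₀ g₀) ,
        subst (p ∣_) (trans (sym (∑-distrib-+ (λ j → coeff f (var j) ℤ.* v j) (λ j → coeff g (var j) ℤ.* v j)))
                            (sum-cong-≗ (λ j → trans (sym (ℤ.*-distribʳ-+ (v j) (coeff f (var j)) (coeff g (var j))))
                                                     (cong (ℤ._* v j) (sym (coeff-++ f g (var j)))))))
              (∣m∣n⇒∣m+n p∣f p∣g)
    ; *-closed = scale
    }
    where
    scale : ∀ a s {f} → Flat f → Flat (scaleₚ a s f)
    scale a s {f} (f₀ , p∣f) with s ≟ᵗ 𝟏
    ... | yes refl = trans (coeff-scale-𝟏 a f 𝟏) (trans (cong (ℤ._*_ a) f₀) (ℤ.*-zeroʳ a)) ,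
      subst (p ∣_) (trans (a*dot (λ j → coeff f (var j)) v) (sum-cong-≗ (λ j → cong (ℤ._* v j) (sym (coeff-scale-𝟏 a f (var j))))))
            (∣n⇒∣m*n a p∣f)
      where
      a*dot : ∀ {k} (x v : Vector ℤ k) → a ℤ.* dotℤ x v ≡ dotℤ (λ j → a ℤ.* x j) v
      a*dot {zero}  x v = ℤ.*-zeroʳ a
      a*dot {suc k} x v = trans (ℤ.*-distribˡ-+ a (x Fin.zero ℤ.* v Fin.zero) (dotℤ (x ∘ Fin.suc) (v ∘ Fin.suc)))
        (cong₂ ℤ._+_ (sym (ℤ.*-assoc a (x Fin.zero) (v Fin.zero))) (a*dot (x ∘ Fin.suc) (v ∘ Fin.suc)))
    ... | no s≢𝟏 = coeff-scale-∤ a s f (λ (u , eq) → s≢𝟏 (proj₁ (𝟏-factor {s = s} {u} (sym eq)))) ,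
      ∣-sum λ j → divides 0ℤ (cong (ℤ._* v j) (vanish j))
      where
      vanish : ∀ j → coeff (scaleₚ a s f) (var j) ≡ 0ℤ
      vanish j with factor? s (var j)
      ... | no ¬s∣xⱼ = coeff-scale-∤ a s f ¬s∣xⱼ
      ... | yes (u , xⱼ≡su) with var-factor {s = s} {u} j (sym xⱼ≡su)
      ...   | inj₁ s≡𝟏  = ⊥-elim (s≢𝟏 s≡𝟏)
      ...   | inj₂ refl = trans (cong (coeff (scaleₚ a s f)) xⱼ≡su) (trans (coeff-scale a s f 𝟏) (trans (cong (ℤ._*_ a) f₀) (ℤ.*-zeroʳ a)))

  linearForm-flat : ∀ a → p ∣ dotℤ a v → Flat (linearForm a)
  linearForm-flat a p∣av = coeff-formalSum-∉ var a var≢𝟏 ,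
    subst (p ∣_) (sum-cong-≗ (λ j → cong (ℤ._* v j) (sym (coeff-formalSum var a var-injective j)))) p∣av

-- Double negation and Dickson's lemma

¬¬-bind : {A B : Set} → ¬ ¬ A → (A → ¬ ¬ B) → ¬ ¬ B
¬¬-bind ¬¬a f ¬b = ¬¬a λ a → f a ¬b

¬¬-Fin : ∀ {n} {P : Fin n → Set} → (∀ i → ¬ ¬ P i) → ¬ ¬ (∀ i → P i)
¬¬-Fin {zero}  ¬¬P k = k λ ()
¬¬-Fin {suc n} ¬¬P = ¬¬-bind (¬¬P Fin.zero) λ p → ¬¬-map (Fin.∀-cons p) (¬¬-Fin (¬¬P ∘ Fin.suc))

-- Divisibility of terms is required only between elements with the same label; the label will be a
-- leading coefficient. `F` is an arbitrary type, so that sets of terms without a membership test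
-- are covered.
FiniteBasis : ∀ {m l} (F : Set) → (F → Fin m) → (F → Term l) → Set
FiniteBasis F κ μ = ∃[ B ] ∀ f → Any (λ b → κ b ≡ κ f × μ b ∣ᵗ μ f) B

-- Dickson's lemma for labelled terms, proved by slicing along the first
-- exponent: a basis for the remaining exponents dominates all elements whose
-- first exponent is large, and only finitely many slices are left.
dickson : ∀ {l m} (F : Set) (κ : F → Fin m) (μ : F → Term l) → ¬ ¬ FiniteBasis F κ μ
-- Without variables only the labels remain. Deciding which of the finitely many labels occur is
-- where excluded middle enters, under double negation.
dickson {zero} {m} F κ μ = ¬¬-map basis (¬¬-Fin (λ i → ¬¬-excluded-middle {A = ∃[ f ] κ f ≡ i}))
  where
  basis : (∀ i → Dec (∃[ f ] κ f ≡ i)) → FiniteBasis F κ μ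
  basis inhabited? = concat (tabulate representative) , λ f →
    Any.concat⁺ (Any.tabulate⁺ (κ f) (represents f))
    where
    representative : Fin m → List F
    representative i with inhabited? i
    ... | yes (f , _) = f ∷ []
    ... | no _        = []
    represents : ∀ f → Any (λ b → κ b ≡ κ f × μ b ∣ᵗ μ f) (representative (κ f))
    represents f with inhabited? (κ f)
    ... | yes (g , κg≡κf) = here (κg≡κf , [] , []-unique (μ f))
      where []-unique : ∀ t → t ≡ [] · μ g
            []-unique t with t | μ g
            ... | [] | [] = refl
    ... | no ∄f = ⊥-elim (∄f (f , refl))
dickson {suc l} F κ μ = ¬¬-bind (dickson F κ (Vec.tail ∘ μ)) λ (B , dominates) →
  let N = max 0 (map exponent B) in
  ¬¬-map (basis B dominates)
    (¬¬-Fin λ (n : Fin N) → dickson (∃[ f ] exponent f ≡ toℕ n) (κ ∘ proj₁) (Vec.tail ∘ μ ∘ proj₁))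
  where
  exponent : F → ℕ
  exponent = Vec.head ∘ μ

  ∷-divides : ∀ (s t : Term (suc l)) → Vec.head s ℕ.≤ Vec.head t → Vec.tail s ∣ᵗ Vec.tail t → s ∣ᵗ t
  ∷-divides (m ∷ s) (n ∷ t) m≤n (u , eq) = (n ℕ.∸ m) ∷ u , cong₂ _∷_ (sym (ℕ.m∸n+n≡m m≤n)) eq

  basis : ∀ B → (∀ f → Any (λ b → κ b ≡ κ f × Vec.tail (μ b) ∣ᵗ Vec.tail (μ f)) B) →
          ((n : Fin (max 0 (map exponent B))) →
             FiniteBasis (∃[ f ] exponent f ≡ toℕ n) (κ ∘ proj₁) (Vec.tail ∘ μ ∘ proj₁)) →
          FiniteBasis F κ μ
  basis B dominates slices = B ++ concat (tabulate (map proj₁ ∘ proj₁ ∘ slices)) , covers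
    where
    covers : ∀ f → Any (λ b → κ b ≡ κ f × μ b ∣ᵗ μ f) (B ++ concat (tabulate (map proj₁ ∘ proj₁ ∘ slices)))
    covers f with exponent f ℕ.<? max 0 (map exponent B)
    ... | no N≰e with b , b∈B , κ≡ , t∣ ← find (dominates f) = Any.++⁺ˡ (lose b∈B (κ≡ , ∷-divides (μ b) (μ f)
          (ℕ.≤-trans (All.lookup (xs≤max 0 (map exponent B)) (∈-map⁺ exponent b∈B)) (ℕ.≮⇒≥ N≰e)) t∣))
    ... | yes e<N = Any.++⁺ʳ B (Any.concat⁺ (Any.tabulate⁺ n (Any.map⁺
          (Any.map (λ {(b , eb≡n)} (κ≡ , t∣) → κ≡ , ∷-divides (μ b) (μ f) (ℕ.≤-reflexive (trans eb≡n (sym e≡n))) t∣)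
                   (proj₂ (slices n) (f , e≡n))))))
      where
      n = fromℕ< e<N
      e≡n = sym (Fin.toℕ-fromℕ< e<N)

∈-─ : ∀ {A : Set} {x y : A} {xs} (y∈xs : y ∈ xs) → x ∈ xs → x ≡ y ⊎ x ∈ (xs ─ y∈xs)
∈-─ (here refl) (here refl) = inj₁ refl
∈-─ (here refl) (there x∈)  = inj₂ x∈
∈-─ (there y∈)  (here refl) = inj₂ (here refl)
∈-─ (there y∈)  (there x∈)  = [ inj₁ , inj₂ ∘ there ]′ (∈-─ y∈ x∈)

─-⊆ : ∀ {A : Set} {x y : A} {xs} (y∈xs : y ∈ xs) → x ∈ (xs ─ y∈xs) → x ∈ xs
─-⊆ (here _)   x∈         = there x∈
─-⊆ (there y∈) (here eq)  = here eq
─-⊆ (there y∈) (there x∈) = there (─-⊆ y∈ x∈)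

-- Leading terms, division and strong bases

module _ {l : ℕ} (σ : TermOrdering l) where

  open TermOrdering σ
  open IsStrictTotalOrder isStrictTotalOrder using (compare; irrefl; asym; isStrictPartialOrder) renaming (trans to <-trans)
  open Gröbner σ

  private
    _≤ᵗ_ : Term l → Term l → Set
    s ≤ᵗ t = s ≡ t ⊎ s < t

    ≤-<-trans : ∀ {s t u} → s ≤ᵗ t → t < u → s < u
    ≤-<-trans (inj₁ refl) t<u = t<u
    ≤-<-trans (inj₂ s<t)  t<u = <-trans s<t t<u

  ∣ᵗ⇒≤ : ∀ {s t} → s ∣ᵗ t → s ≤ᵗ t
  ∣ᵗ⇒≤ {s} (u , refl) with u ≟ᵗ 𝟏
  ... | yes refl = inj₁ (sym (·-identityˡ s))
  ... | no u≢𝟏   = inj₂ (subst₂ _<_ (trans (·-comm s 𝟏) (·-identityˡ s)) (·-comm s u) (·-mono-< s (𝟏-min u≢𝟏)))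

  -- A term ordering is a well-ordering: by Dickson's lemma, the smallest
  -- element of a finite basis of the counterexamples is a minimal counterexample.
  <-induction : (P : Term l → Set) → (∀ t → (∀ s → s < t → ¬ ¬ P s) → ¬ ¬ P t) → ∀ t → ¬ ¬ P t
  <-induction P step t ¬Pt = dickson F (λ _ → Fin.zero {0}) proj₁ λ (B , dominates) →
    let m , minimal = minimum (t , ¬Pt) B in
    step (proj₁ m) (λ s s<m ¬Ps → let b , b∈B , _ , b∣s = find (dominates (s , ¬Ps)) in
      All.lookup minimal b∈B (≤-<-trans (∣ᵗ⇒≤ b∣s) s<m)) (proj₂ m)
    where
    F = ∃[ s ] ¬ P s
    minimum : F → (B : List F) → ∃ λ (m : F) → All (λ b → ¬ proj₁ b < proj₁ m) B
    minimum f []      = f , []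
    minimum f (b ∷ B) with m , minimal ← minimum f B with compare (proj₁ b) (proj₁ m)
    ... | tri< b<m _ _ = b , irrefl refl ∷ All.map (λ c≮m c<b → c≮m (<-trans c<b b<m)) minimal
    ... | tri≈ b≮m _ _ = m , b≮m ∷ minimal
    ... | tri> b≮m _ _ = m , b≮m ∷ minimal

  -- Only listed terms can have a nonzero coefficient, so a finite search decides. It tests `coeff`
  -- rather than the listed entries, because entries for the same term may cancel.
  zero-or-LT : ∀ f → f ≈ 0ₚ ⊎ ∃ (IsLT f)
  zero-or-LT f with search (map proj₂ f)
    where
    search : ∀ ts → (∀ {s} → s ∈ ts → coeff f s ≡ 0ℤ) ⊎ ∃ λ t → coeff f t ≢ 0ℤ × ∀ {s} → s ∈ ts → coeff f s ≢ 0ℤ → s ≤ᵗ t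
    search []       = inj₁ λ ()
    search (s ∷ ts) with coeff f s ℤ.≟ 0ℤ | search ts
    ... | yes fs≡0 | inj₁ none            = inj₁ λ { (here refl) → fs≡0 ; (there u∈) → none u∈ }
    ... | yes fs≡0 | inj₂ (t , ft≢0 , ≤t) = inj₂ (t , ft≢0 , λ { (here refl) fs≢0 → contradiction fs≡0 fs≢0 ; (there u∈) → ≤t u∈ })
    ... | no fs≢0  | inj₁ none            = inj₂ (s , fs≢0 , λ { (here refl) _ → inj₁ refl ; (there u∈) fu≢0 → contradiction (none u∈) fu≢0 })
    ... | no fs≢0  | inj₂ (t , ft≢0 , ≤t) with compare s t
    ...   | tri< s<t _ _  = inj₂ (t , ft≢0 , λ { (here refl) _ → inj₂ s<t ; (there u∈) → ≤t u∈ })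
    ...   | tri≈ _ refl _ = inj₂ (t , ft≢0 , λ { (here refl) _ → inj₁ refl ; (there u∈) → ≤t u∈ })
    ...   | tri> _ _ t<s  = inj₂ (s , fs≢0 , λ { (here refl) _ → inj₁ refl ; (there u∈) fu≢0 → inj₂ (≤-<-trans (≤t u∈ fu≢0) t<s) })
  ... | inj₂ (t , ft≢0 , ≤t) = inj₂ (t , record { occurs = ft≢0 ; largest = λ fs≢0 → ≤t (coeff≢0⇒∈ f fs≢0) fs≢0 })
  ... | inj₁ none = inj₁ λ t → decidable-stable (coeff f t ℤ.≟ 0ℤ) λ ft≢0 → ft≢0 (none (coeff≢0⇒∈ f ft≢0))

  LT-unique : ∀ {f s t} → IsLT f s → IsLT f t → s ≡ t
  LT-unique p q with IsLT.largest q (IsLT.occurs p) | IsLT.largest p (IsLT.occurs q)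
  ... | inj₁ s≡t | _        = s≡t
  ... | _        | inj₁ t≡s = sym t≡s
  ... | inj₂ s<t | inj₂ t<s = contradiction t<s (asym s<t)

  IsLT⇒≉0 : ∀ {f t} → IsLT f t → f ≉ 0ₚ
  IsLT⇒≉0 {t = t} p f≈0 = IsLT.occurs p (f≈0 t)

  IsLT-resp-≈ : ∀ {f g t} → f ≈ g → IsLT f t → IsLT g t
  IsLT-resp-≈ f≈g p = record
    { occurs  = λ gt≡0 → occurs (trans (f≈g _) gt≡0)
    ; largest = λ gs≢0 → largest (λ fs≡0 → gs≢0 (trans (sym (f≈g _)) fs≡0))
    } where
    open IsLT p

  monomial-LT : ∀ {c t} → c ≢ 0ℤ → IsLT ((c , t) ∷ []) t
  monomial-LT {c} {t} c≢0 = record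
    { occurs  = λ eq → c≢0 (trans (sym (ℤ.+-identityʳ c)) (trans (sym (coeff-here c t [])) eq))
    ; largest = λ {s} coeff≢0 → case-≟ s coeff≢0 (t ≟ᵗ s)
    }
    where
    case-≟ : ∀ s → coeff ((c , t) ∷ []) s ≢ 0ℤ → Dec (t ≡ s) → s ≤ᵗ t
    case-≟ s _       (yes t≡s) = inj₁ (sym t≡s)
    case-≟ s coeff≢0 (no t≢s)  = contradiction (coeff-skip c [] t≢s) coeff≢0

  LM∣-intro : ∀ {f g s t} → IsLT g s → IsLT f t → coeff g s ∣ coeff f t → s ∣ᵗ t → g LM∣ f
  LM∣-intro {f} {g} {s} g-lt f-lt (divides q eq) (u , refl) =
    _ , _ , (s , g-lt , refl) , (_ , f-lt , refl) , (q , u) ∷ [] , λ t → cong (λ c → coeff ((c , u · s) ∷ []) t) eq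

  -- The cofactor `h` is an arbitrary polynomial, but each of its entries contributes to `t` a
  -- multiple of `coeff g s`, and none contributes anything unless `s` divides `t`.
  LM∣-elim : ∀ {f g} → g LM∣ f → ∃₂ λ s t → IsLT g s × IsLT f t × coeff g s ∣ coeff f t × s ∣ᵗ t
  LM∣-elim {f} {g} (_ , _ , (s , g-lt , refl) , (t , f-lt , refl) , h , eq) = s , t , g-lt , f-lt ,
    subst (coeff g s ∣_) (sym ft≡) (coefficients h) , decidable-stable ∣ᵗ? (λ s∤t → IsLT.occurs f-lt (trans ft≡ (vanish s∤t h)))
    where
    m = (coeff g s , s) ∷ []
    ft≡ : coeff f t ≡ coeff (h *ₚ m) t
    ft≡ = trans (sym (ℤ.+-identityʳ _)) (trans (sym (coeff-here (coeff f t) t [])) (eq t))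
    ∣ᵗ? : Dec (s ∣ᵗ t)
    ∣ᵗ? with factor? s t
    ... | yes (u , t≡su) = yes (u , trans t≡su (·-comm s u))
    ... | no ¬s∣t        = no λ (u , t≡us) → ¬s∣t (u , trans t≡us (·-comm u s))
    coefficients : ∀ h → coeff g s ∣ coeff (h *ₚ m) t
    coefficients [] = divides 0ℤ refl
    coefficients ((a , u) ∷ h) with u · s ≟ᵗ t
    ... | yes _ = ℤ.∣m∣n⇒∣m+n (∣n⇒∣m*n a ℤ.∣-refl) (coefficients h)
    ... | no _  = ℤ.∣m∣n⇒∣m+n {m = 0ℤ} (divides 0ℤ refl) (coefficients h)
    vanish : ¬ s ∣ᵗ t → ∀ h → coeff (h *ₚ m) t ≡ 0ℤ
    vanish s∤t [] = refl
    vanish s∤t ((a , u) ∷ h) = trans (coeff-skip (a ℤ.* coeff g s) (h *ₚ m) (λ us≡t → s∤t (u , sym us≡t))) (vanish s∤t h)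

  LM∣-trans : ∀ {f g h} → f LM∣ g → g LM∣ h → f LM∣ h
  LM∣-trans {f} {g} {h} f∣g g∣h with LM∣-elim f∣g | LM∣-elim g∣h
  ... | s , t , f-lt , g-lt , c∣ , (w , t≡ws) | t′ , u , g-lt′ , h-lt , c∣′ , (w′ , u≡w′t) with refl ← LT-unique g-lt g-lt′ =
    LM∣-intro f-lt h-lt (∣-trans c∣ c∣′) (w′ · w , trans u≡w′t (trans (cong (w′ ·_) t≡ws) (sym (·-assoc w′ w s))))

  -- One division step: the leading monomials cancel, and the other terms of the subtracted multiple
  -- stay below `t` by monotonicity. All occurring terms are bounded, rather than a leading term,
  -- since the remainder may be zero.
  reduce : ∀ {f g} → g LM∣ f → ∃ λ t → IsLT f t × ∃₂ λ q w → ∀ {s} → coeff (f ++ scaleₚ (ℤ.- q) w g) s ≢ 0ℤ → s < t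
  reduce {f} {g} g∣f with s , t , g-lt , f-lt , divides q ft≡qgs , (w , refl) ← LM∣-elim g∣f = t , f-lt , q , w , smaller
    where
    f′ = f ++ scaleₚ (ℤ.- q) w g
    cancel : ∀ q c → q ℤ.* c ℤ.+ ℤ.- q ℤ.* c ≡ 0ℤ
    cancel = ℤ-Solver.solve-∀
    f′t≡0 : coeff f′ t ≡ 0ℤ
    f′t≡0 = trans (coeff-++ f _ t) (trans (cong₂ ℤ._+_ ft≡qgs (coeff-scale (ℤ.- q) w g s)) (cancel q (coeff g s)))
    ≤t : ∀ {r} → coeff f′ r ≢ 0ℤ → r ≤ᵗ t
    ≤t {r} f′r≢0 with coeff f r ℤ.≟ 0ℤ
    ... | no fr≢0  = IsLT.largest f-lt fr≢0
    ... | yes fr≡0 with factor? w r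
    ...   | no ¬w∣r = contradiction (trans (coeff-++ f _ r) (cong₂ ℤ._+_ fr≡0 (coeff-scale-∤ (ℤ.- q) w g ¬w∣r))) f′r≢0
    ...   | yes (u , refl) with coeff g u ℤ.≟ 0ℤ
    ...     | yes gu≡0 = contradiction (trans (coeff-++ f _ r) (cong₂ ℤ._+_ fr≡0 (trans (coeff-scale (ℤ.- q) w g u)
                           (trans (cong (ℤ._*_ (ℤ.- q)) gu≡0) (ℤ.*-zeroʳ (ℤ.- q)))))) f′r≢0
    ...     | no gu≢0 with IsLT.largest g-lt gu≢0
    ...       | inj₁ refl = inj₁ refl
    ...       | inj₂ u<s  = inj₂ (·-mono-< w u<s)
    smaller : ∀ {r} → coeff f′ r ≢ 0ℤ → r < t
    smaller f′r≢0 with ≤t f′r≢0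
    ... | inj₁ refl = contradiction f′t≡0 f′r≢0
    ... | inj₂ r<t  = r<t

  record IsStrongBasis (I : Pred (Poly l) 0ℓ) (G : List (Poly l)) : Set where
    field
      nonzero   : All (_≉ 0ₚ) G
      contained : All I G
      strong    : ∀ f → I f → f ≉ 0ₚ → Any (_LM∣ f) G

  -- Repeated division by `G`. It terminates by `<-induction`, which holds only up to double
  -- negation, and the conclusion inherits this.
  strongBasis-generates : ∀ {I G} → IsIdeal I → IsStrongBasis I G → ∀ f → I f → ¬ ¬ ⟨ lookup G ⟩ f
  strongBasis-generates {I} {G} ideal basis = reduces
    where
    open IsStrongBasis basis
    open IsIdeal ideal
    module J = IsIdeal (⟨⟩-isIdeal (lookup G))

    J-G : ∀ {g} → g ∈ G → ⟨ lookup G ⟩ g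
    J-G g∈G = subst ⟨ lookup G ⟩ (sym (Any.lookup-index g∈G)) (⟨⟩-generator (lookup G) (Any.index g∈G))

    P : Term l → Set
    P t = ∀ f → I f → IsLT f t → ¬ ¬ ⟨ lookup G ⟩ f

    step : ∀ t → (∀ s → s < t → ¬ ¬ P s) → ¬ ¬ P t
    step t ih ¬Pt = ¬Pt λ f f∈I f-lt →
      let g , g∈G , g∣f = find (strong f f∈I (IsLT⇒≉0 f-lt))
          t′ , f-lt′ , q , w , smaller = reduce g∣f
          r = scaleₚ (ℤ.- q) w g
          f∈J : ⟨ lookup G ⟩ (f ++ r) → ⟨ lookup G ⟩ f
          f∈J f+r∈J = J.≈-closed {(f ++ r) ++ scaleₚ (ℤ.- + 1) 𝟏 r} {f} (λ s → trans (coeff-++ (f ++ r) (scaleₚ (ℤ.- + 1) 𝟏 r) s)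
                        (trans (cong₂ ℤ._+_ (coeff-++ f r s) (coeff-scale-𝟏 (ℤ.- + 1) r s)) (cancel (coeff f s) (coeff r s))))
                        (J.+-closed {f ++ r} f+r∈J (J.*-closed (ℤ.- + 1) 𝟏 {r} (J.*-closed (ℤ.- q) w {g} (J-G g∈G))))
          f+r∈I = +-closed f∈I (*-closed (ℤ.- q) w (All.lookup contained g∈G))
      in case-zero (f ++ r) (zero-or-LT (f ++ r)) f+r∈I
           (λ s s-lt → subst (s <_) (LT-unique f-lt′ f-lt) (smaller (IsLT.occurs s-lt))) f∈J
      where
      cancel : ∀ x y → x ℤ.+ y ℤ.+ ℤ.- + 1 ℤ.* y ≡ x
      cancel = ℤ-Solver.solve-∀
      case-zero : ∀ f′ → f′ ≈ 0ₚ ⊎ ∃ (IsLT f′) → I f′ → (∀ s → IsLT f′ s → s < t) →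
                  ∀ {X : Set} → (⟨ lookup G ⟩ f′ → X) → ¬ ¬ X
      case-zero f′ (inj₁ f′≈0)       f′∈I <t k = contradiction (k (J.≈-closed {[]} {f′} (λ s → sym (f′≈0 s)) J.0-closed))
      case-zero f′ (inj₂ (s , s-lt)) f′∈I <t k = ¬¬-bind (ih s (<t s s-lt)) λ Ps → ¬¬-map k (Ps f′ f′∈I s-lt)

    reduces : ∀ f → I f → ¬ ¬ ⟨ lookup G ⟩ f
    reduces f f∈I with zero-or-LT f
    ... | inj₁ f≈0        = contradiction (J.≈-closed {[]} {f} (λ s → sym (f≈0 s)) J.0-closed)
    ... | inj₂ (t , f-lt) = ¬¬-bind (<-induction P step t) λ Pt → Pt f f∈I f-lt

  Minimal : List (Poly l) → Set
  Minimal G = ∀ {g g′} → g ∈ G → g′ ∈ G → g ≉ g′ → ¬ g LM∣ g′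

  -- A strong basis of least length is minimal.
  minimise : ∀ {I} n G → length G ℕ.≤ n → IsStrongBasis I G → ¬ ¬ (∃[ G′ ] IsStrongBasis I G′ × Minimal G′)
  minimise zero    []      _   basis none = none ([] , basis , λ ())
  minimise {I} (suc n) G len basis none = none (G , basis , minimal)
    where
    open IsStrongBasis basis
    minimal : Minimal G
    minimal {g} {g′} g∈G g′∈G g≉g′ g∣g′ =
      minimise n (G ─ g′∈G) (ℕ.≤-pred (ℕ.≤-trans (ℕ.≤-reflexive (sym (List.length-removeAt′ G (Any.index g′∈G)))) len)) (record
        { nonzero   = All.tabulate (All.lookup nonzero ∘ ─-⊆ g′∈G)
        ; contained = All.tabulate (All.lookup contained ∘ ─-⊆ g′∈G)
        ; strong    = still-strong
        }) none
      where
      still-strong : ∀ f → I f → f ≉ 0ₚ → Any (_LM∣ f) (G ─ g′∈G)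
      still-strong f f∈I f≉0 with h , h∈G , h∣f ← find (strong f f∈I f≉0) with ∈-─ g′∈G h∈G
      ... | inj₂ h∈ = lose h∈ h∣f
      ... | inj₁ refl with ∈-─ g′∈G g∈G
      ...   | inj₁ refl = ⊥-elim (g≉g′ (λ t → refl))
      ...   | inj₂ g∈   = lose g∈ (LM∣-trans g∣g′ h∣f)

  -- Ideals of linear forms containing every `D x_j`

  module _ {k : ℕ} (a : Fin k → Vector ℤ l) {D : ℤ} (D≢0 : D ≢ 0ℤ)
           (units : ∀ j → ⟨ linearForm ∘ a ⟩ (linearForm (scaledUnit D j))) where

    private
      I : Pred (Poly l) 0ℓ
      I = ⟨ linearForm ∘ a ⟩

      I-ideal : IsIdeal I
      I-ideal = ⟨⟩-isIdeal (linearForm ∘ a)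
      open IsIdeal I-ideal

      I-flat : ∀ {p v} → (∀ i → p ∣ dotℤ (a i) v) → ∀ {f} → I f → Flat p v f
      I-flat {p} {v} killed {f} = ⟨⟩-least (flat-isIdeal p v) (λ i → linearForm-flat p v (a i) (killed i)) {f}

      constant-free : ∀ {f} → I f → coeff f 𝟏 ≡ 0ℤ
      -- Any flat direction will do, as only the constant coefficient is read off.
      constant-free {f} f∈I = proj₁ (I-flat {p = + 1} {v = λ _ → 0ℤ} (λ i → divides (dotℤ (a i) (λ _ → 0ℤ)) (sym (ℤ.*-identityʳ _))) {f} f∈I)

      LT≢𝟏 : ∀ {f t} → I f → IsLT f t → t ≢ 𝟏
      LT≢𝟏 {f} f∈I f-lt refl = IsLT.occurs f-lt (constant-free {f} f∈I)

      -- Elements of `I` have no constant coefficient, so this reaches every term that can lead, and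
      -- `D` can be mixed into any leading coefficient.
      D·∈I : ∀ {t} → t ≢ 𝟏 → I ((D , t) ∷ [])
      D·∈I {t} t≢𝟏 with j , u , t≡uxⱼ ← var-divides t≢𝟏 =
        subst I (cong₂ (λ c r → (c , r) ∷ []) (ℤ.*-identityˡ D) (sym t≡uxⱼ))
          (*-closed (+ 1) u {(D , var j) ∷ []} (≈-closed {linearForm (scaledUnit D j)} {(D , var j) ∷ []} (formalSum-unit var D j) (units j)))

    -- The coefficients of t in the elements of I with leading term t form an
    -- ideal of ℤ containing D, so every leading coefficient can be replaced
    -- by its gcd with D.
    abstract
      refine : ∀ {f t} → I f → IsLT f t →
               ∃ λ (d : ℕ) → + d ∣ coeff f t × + d ∣ D × ∃ λ f′ → I f′ × IsLT f′ t × coeff f′ t ≡ + d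
      refine {f} {t} f∈I f-lt with d , (u , v , uc+vD≡d) , d∣c , d∣D ← bezout (coeff f t) D =
        d , d∣c , d∣D , f′ , +-closed {scaleₚ u 𝟏 f} (*-closed u 𝟏 {f} f∈I) (*-closed v 𝟏 {m} (D·∈I (LT≢𝟏 {f} f∈I f-lt))) ,
        record { occurs = λ f′t≡0 → d≢0 (trans (sym f′t≡d) f′t≡0) ; largest = largest } , f′t≡d
        where
        m f′ : Poly l
        m = (D , t) ∷ []
        f′ = scaleₚ u 𝟏 f ++ scaleₚ v 𝟏 m
        coeff-f′ : ∀ s → coeff f′ s ≡ u ℤ.* coeff f s ℤ.+ v ℤ.* coeff m s
        coeff-f′ s = trans (coeff-++ (scaleₚ u 𝟏 f) (scaleₚ v 𝟏 m) s) (cong₂ ℤ._+_ (coeff-scale-𝟏 u f s) (coeff-scale-𝟏 v m s))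
        f′t≡d : coeff f′ t ≡ + d
        f′t≡d = trans (coeff-f′ t) (trans (cong (λ z → u ℤ.* coeff f t ℤ.+ v ℤ.* z) (trans (coeff-here D t []) (ℤ.+-identityʳ D))) uc+vD≡d)
        d≢0 : + d ≢ 0ℤ
        d≢0 d≡0 = D≢0 (ℤ.0∣⇒≡0 (subst (_∣ D) d≡0 d∣D))
        largest : ∀ {s} → coeff f′ s ≢ 0ℤ → s ≡ t ⊎ s < t
        largest {s} f′s≢0 with t ≟ᵗ s
        ... | yes t≡s = inj₁ (sym t≡s)
        ... | no t≢s  = IsLT.largest f-lt λ fs≡0 → f′s≢0 (trans (coeff-f′ s)
              (cong₂ ℤ._+_ (trans (cong (ℤ._*_ u) fs≡0) (ℤ.*-zeroʳ u)) (trans (cong (ℤ._*_ v) (coeff-skip D [] t≢s)) (ℤ.*-zeroʳ v))))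

    private
      record Candidate : Set where
        field
          poly   : Poly l
          term   : Term l
          label  : Fin (suc ℤ.∣ D ∣)
          ∈I     : I poly
          lt     : IsLT poly term
          coeff≡ : coeff poly term ≡ + toℕ label

    -- By `refine`, the leading monomial of any `f` is a multiple of that of a candidate whose
    -- coefficient `d` divides `D`. Since `d` is at most `|D|`, there are finitely many labels, and
    -- a basis element with the same label and a dividing term has a dividing leading monomial.
    strongBasis-exists : ¬ ¬ ∃ (IsStrongBasis I)
    strongBasis-exists = ¬¬-map basis (dickson Candidate Candidate.label Candidate.term)
      where
      basis : FiniteBasis Candidate Candidate.label Candidate.term → ∃ (IsStrongBasis I)
      basis (B , dominates) = map Candidate.poly B , record
        { nonzero   = All.map⁺ (All.universal (IsLT⇒≉0 ∘ Candidate.lt) B)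
        ; contained = All.map⁺ (All.universal Candidate.∈I B)
        ; strong    = strong
        }
        where
        strong : ∀ f → I f → f ≉ 0ₚ → Any (_LM∣ f) (map Candidate.poly B)
        strong f f∈I f≉0 with zero-or-LT f
        ... | inj₁ f≈0 = contradiction f≈0 f≉0
        ... | inj₂ (t , f-lt) with d , d∣c , d∣D , f′ , f′∈I , f′-lt , f′t≡d ← refine {f} f∈I f-lt =
          Any.map⁺ (Any.map (λ {b} (label≡ , b∣t) → LM∣-intro (Candidate.lt b) f-lt
            (subst (_∣ coeff f t) (sym (trans (Candidate.coeff≡ b) (cong +_ (trans (cong toℕ label≡) (Fin.toℕ-fromℕ< d<))))) d∣c) b∣t)
            (dominates record { poly = f′ ; term = t ; label = fromℕ< d< ; ∈I = f′∈I ; lt = f′-lt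
                              ; coeff≡ = trans f′t≡d (cong +_ (sym (Fin.toℕ-fromℕ< d<))) }))
          where
          instance D-nonZero = ℤ.≢-nonZero D≢0
          d< : d ℕ.< suc ℤ.∣ D ∣
          d< = s≤s (ℕ.∣⇒≤ (ℤ.∣⇒∣ᵤ d∣D))

    gröbnerBasis-exists : ¬ ¬ ∃ (IsMinimalStrongGröbnerBasis I)
    gröbnerBasis-exists =
      ¬¬-bind strongBasis-exists λ (G₀ , basis₀) →
      ¬¬-bind (minimise (length G₀) G₀ ℕ.≤-refl basis₀) λ (G , basis , minimal) →
      ¬¬-map (λ generators → G , record
        { nonzero   = IsStrongBasis.nonzero basis
        ; contained = IsStrongBasis.contained basis
        ; generates = λ f → ⟨⟩-least (⟨⟩-isIdeal (lookup G)) generators {f}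
        ; strong    = IsStrongBasis.strong basis
        ; minimal   = minimal
        })
        (¬¬-Fin λ i → strongBasis-generates I-ideal basis (linearForm (a i)) (⟨⟩-generator (linearForm ∘ a) i))

    lucky⇒kernel-trivial : ∀ {p} → (∀ x y → + p ∣ x ℤ.* y → + p ∣ x ⊎ + p ∣ y) → Lucky p I →
                           ∀ v → (∀ i → + p ∣ dotℤ (a i) v) → ∀ j → + p ∣ v j
    lucky⇒kernel-trivial {p} euclid lucky v killed j = decidable-stable (+ p ∣? v j)
      -- The induction runs over the finitely many variables, ordered by `σ`, so it is well founded
      -- outright.
      (¬¬-map (λ (G , gb) → induct G gb j (spo-wellFounded (On.isStrictPartialOrder var isStrictPartialOrder) j)) gröbnerBasis-exists)
      where
      ∣-summand : ∀ {k q} (f : Vector ℤ k) j → q ∣ sum f → (∀ i → i ≢ j → q ∣ f i) → q ∣ f j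
      ∣-summand f Fin.zero    q∣Σ q∣f = ∣m+n∣n⇒∣m q∣Σ (∣-sum (λ i → q∣f (Fin.suc i) λ ()))
      ∣-summand f (Fin.suc j) q∣Σ q∣f = ∣-summand (f ∘ Fin.suc) j (∣m+n∣m⇒∣n q∣Σ (q∣f Fin.zero λ ()))
                                          (λ i i≢j → q∣f (Fin.suc i) (i≢j ∘ Fin.suc-injective))

      induct : ∀ G → IsMinimalStrongGröbnerBasis I G → ∀ j → Acc (λ i j → var i < var j) j → + p ∣ v j
      induct G gb j (acc smaller) with find (strong ((D , var j) ∷ []) (D·∈I (var≢𝟏 j)) (IsLT⇒≉0 (monomial-LT {D} {var j} D≢0)))
        where
        open IsMinimalStrongGröbnerBasis gb
      ... | g , g∈G , g∣Dxⱼ with s , t , g-lt , xⱼ-lt , _ , (u , t≡us) ← LM∣-elim g∣Dxⱼ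
                          with refl ← LT-unique xⱼ-lt (monomial-LT {D} {var j} D≢0)
                          with var-factor {s = u} {s} j (sym t≡us)
      ...   | inj₂ s≡𝟏  = contradiction s≡𝟏 (LT≢𝟏 {g} g∈I g-lt)
        where g∈I = All.lookup (IsMinimalStrongGröbnerBasis.contained gb) g∈G
      ...   | inj₁ refl with refl ← trans t≡us (·-identityˡ s) =
        -- Flatness of `g` makes `p` divide the whole sum. Variables above `x_j` do not occur in
        -- `g`, and those below are settled by induction, so `p` divides the summand at `j`;
        -- luckiness rules out its first factor.
        [ (λ p∣c → contradiction p∣c (lucky G gb g∈G (_ , g-lt , refl))) , id ]′
          (euclid (coeff g (var j)) (v j) (∣-summand (λ i → coeff g (var i) ℤ.* v i) j (proj₂ (I-flat killed {g} g∈I)) others))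
        where
        g∈I = All.lookup (IsMinimalStrongGröbnerBasis.contained gb) g∈G
        others : ∀ i → i ≢ j → + p ∣ coeff g (var i) ℤ.* v i
        others i i≢j with coeff g (var i) ℤ.≟ 0ℤ
        ... | yes gi≡0 = subst (λ c → + p ∣ c ℤ.* v i) (sym gi≡0) (divides 0ℤ refl)
        ... | no gi≢0 with IsLT.largest g-lt gi≢0
        ...   | inj₁ xᵢ≡xⱼ = contradiction (var-injective xᵢ≡xⱼ) i≢j
        ...   | inj₂ xᵢ<xⱼ = ∣n⇒∣m*n (coeff g (var i)) (induct G gb i (smaller xᵢ<xⱼ))

    -- Some `h` in `G` has a leading monomial dividing the refined one, hence also that of `g`. If
    -- `h` were `g`, its leading coefficient would divide `D`, and with it `p` would; so `h` and `g`
    -- differ and contradict minimality.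
    p∤D⇒lucky : ∀ {p} → ¬ + p ∣ D → Lucky p I
    p∤D⇒lucky {p} p∤D G gb {g} g∈G (t , g-lt , refl) p∣c
      with d , d∣c , d∣D , f , f∈I , f-lt , ft≡d ← refine {g} (All.lookup (IsMinimalStrongGröbnerBasis.contained gb) g∈G) g-lt
      with h , h∈G , h∣f ← find (IsMinimalStrongGröbnerBasis.strong gb f f∈I (IsLT⇒≉0 f-lt))
      with s , t′ , h-lt , f-lt′ , c′∣d , s∣t ← LM∣-elim h∣f
      with refl ← LT-unique f-lt′ f-lt =
      IsMinimalStrongGröbnerBasis.minimal gb h∈G g∈G h≉g
        (LM∣-intro h-lt g-lt (∣-trans c′∣d (subst (_∣ coeff g t) (sym ft≡d) d∣c)) s∣t)
      where
      h≉g : h ≉ g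
      h≉g h≈g with refl ← LT-unique (IsLT-resp-≈ h≈g h-lt) g-lt =
        p∤D (∣-trans p∣c (∣-trans (subst (_∣ coeff f t) (h≈g s) c′∣d) (subst (_∣ D) (sym ft≡d) d∣D)))

-- The fields ℚ and ℤ/p

ℚ-inverse : ∀ x → x ≢ 0ℚ → ∃[ y ] y ℚ.* x ≡ 1ℚ
ℚ-inverse x x≢0 = ℚ.1/ x , ℚ.*-inverseˡ x
  where instance _ = ℚ.≢-nonZero x≢0

ℚ-isField : IsField ℚ-ring
ℚ-isField = record { _≟0 = ℚ._≟ 0ℚ ; 1≉0 = λ () ; inverse = ℚ-inverse }

module Lℚ = FieldLinear ℚ-ring ℚ-isField

≡0⇒∣ : ∀ {p x} → x ≡ 0ℤ [mod p ] → + p ∣ x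
≡0⇒∣ {p} {x} (mod d) = subst (+ p ∣_) (ℤ.+-identityʳ x) d

∣⇒≡0 : ∀ {p x} → + p ∣ x → x ≡ 0ℤ [mod p ]
∣⇒≡0 {p} {x} d = mod (subst (+ p ∣_) (sym (ℤ.+-identityʳ x)) d)

module _ {p : ℕ} (prime-p : Prime p) where

  prime∤1 : ¬ + p ∣ + 1
  prime∤1 p∣1 with ℕ.∣1⇒≡1 (ℤ.∣⇒∣ᵤ p∣1)
  ... | refl = ¬prime[1] prime-p

  prime-euclid : ∀ x y → + p ∣ x ℤ.* y → + p ∣ x ⊎ + p ∣ y
  prime-euclid x y p∣xy = Sum.map ℤ.∣ᵤ⇒∣ ℤ.∣ᵤ⇒∣
    (euclidsLemma ℤ.∣ x ∣ ℤ.∣ y ∣ prime-p (subst (p ℕ.∣_) (ℤ.abs-* x y) (ℤ.∣⇒∣ᵤ p∣xy)))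

  prime-inverse : ∀ x → ¬ x ≡ 0ℤ [mod p ] → ∃[ y ] (y ℤ.* x) ≡ (+ 1) [mod p ]
  prime-inverse x x≢0 with bezout x (+ p)
  ... | d , (u , v , ux+vp≡d) , d∣x , d∣p with prime⇒irreducible prime-p (ℤ.∣⇒∣ᵤ d∣p)
  ...   | inj₂ refl = ⊥-elim (x≢0 (∣⇒≡0 d∣x))
  ...   | inj₁ refl = u , mod (divides (ℤ.- v) (trans (cong (λ z → u ℤ.* x ℤ.- z) (sym ux+vp≡d)) (lemma (u ℤ.* x) v (+ p))))
    where lemma : ∀ z v p → z ℤ.- (z ℤ.+ v ℤ.* p) ≡ ℤ.- v ℤ.* p
          lemma = ℤ-Solver.solve-∀

  ℤ/p-isField : IsField (ℤ/ p)
  ℤ/p-isField = record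
    { _≟0 = λ x → map′ ∣⇒≡0 ≡0⇒∣ (+ p ∣? x) ; 1≉0 = prime∤1 ∘ ≡0⇒∣ ; inverse = prime-inverse }

/1-homo-+ : ∀ x y → (x ℤ.+ y) ℚ./ 1 ≡ x ℚ./ 1 ℚ.+ y ℚ./ 1
/1-homo-+ x y = ℚ.toℚᵘ-injective (begin
  ℚ.toℚᵘ ((x ℤ.+ y) ℚ./ 1)                       ≈⟨ ℚ.toℚᵘ-fromℚᵘ (mkℚᵘ (x ℤ.+ y) 0) ⟩
  mkℚᵘ (x ℤ.+ y) 0                               ≈⟨ *≡* (lemma x y) ⟩
  mkℚᵘ x 0 ℚᵘ.+ mkℚᵘ y 0                         ≈⟨ ℚᵘ.+-cong (ℚ.toℚᵘ-fromℚᵘ (mkℚᵘ x 0)) (ℚ.toℚᵘ-fromℚᵘ (mkℚᵘ y 0)) ⟨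
  ℚ.toℚᵘ (x ℚ./ 1) ℚᵘ.+ ℚ.toℚᵘ (y ℚ./ 1)         ≈⟨ ℚ.toℚᵘ-homo-+ (x ℚ./ 1) (y ℚ./ 1) ⟨
  ℚ.toℚᵘ (x ℚ./ 1 ℚ.+ y ℚ./ 1)                   ∎)
  where
  open import Relation.Binary.Reasoning.Setoid ℚᵘ.≃-setoid
  lemma : ∀ x y → (x ℤ.+ y) ℤ.* + 1 ≡ (x ℤ.* + 1 ℤ.+ y ℤ.* + 1) ℤ.* + 1
  lemma = ℤ-Solver.solve-∀

/1-homo-* : ∀ x y → (x ℤ.* y) ℚ./ 1 ≡ x ℚ./ 1 ℚ.* (y ℚ./ 1)
/1-homo-* x y = ℚ.toℚᵘ-injective (begin
  ℚ.toℚᵘ ((x ℤ.* y) ℚ./ 1)                       ≈⟨ ℚ.toℚᵘ-fromℚᵘ (mkℚᵘ (x ℤ.* y) 0) ⟩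
  mkℚᵘ x 0 ℚᵘ.* mkℚᵘ y 0                         ≈⟨ ℚᵘ.*-cong (ℚ.toℚᵘ-fromℚᵘ (mkℚᵘ x 0)) (ℚ.toℚᵘ-fromℚᵘ (mkℚᵘ y 0)) ⟨
  ℚ.toℚᵘ (x ℚ./ 1) ℚᵘ.* ℚ.toℚᵘ (y ℚ./ 1)         ≈⟨ ℚ.toℚᵘ-homo-* (x ℚ./ 1) (y ℚ./ 1) ⟨
  ℚ.toℚᵘ (x ℚ./ 1 ℚ.* (y ℚ./ 1))                   ∎)
  where
  open import Relation.Binary.Reasoning.Setoid ℚᵘ.≃-setoid

/1≡0⇒≡0 : ∀ x → x ℚ./ 1 ≡ 0ℚ → x ≡ 0ℤ
/1≡0⇒≡0 x x/1≡0 with ℚᵘ.≃-trans (ℚᵘ.≃-sym (ℚ.toℚᵘ-fromℚᵘ (mkℚᵘ x 0))) (ℚ.toℚᵘ-cong x/1≡0)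
... | *≡* eq = trans (sym (ℤ.*-identityʳ x)) eq

dotℚ-toℚ : ∀ {l} (a v : Vector ℤ l) → Lℚ.dot (toℚ a) (toℚ v) ≡ dotℤ a v ℚ./ 1
dotℚ-toℚ {zero}  a v = refl
dotℚ-toℚ {suc l} a v = trans
  (cong₂ ℚ._+_ (sym (/1-homo-* (a Fin.zero) (v Fin.zero))) (dotℚ-toℚ (a ∘ Fin.suc) (v ∘ Fin.suc)))
  (sym (/1-homo-+ (a Fin.zero ℤ.* v Fin.zero) (dotℤ (a ∘ Fin.suc) (v ∘ Fin.suc))))

dotℚ-scaledUnit : ∀ {l} D j (w : Vector ℚ l) → Lℚ.dot (toℚ (scaledUnit D j)) w ≡ D ℚ./ 1 ℚ.* w j
dotℚ-scaledUnit D Fin.zero    w = trans (cong (D ℚ./ 1 ℚ.* w Fin.zero ℚ.+_) (Lℚ.sum-zero (λ i → ℚ.*-zeroˡ (w (Fin.suc i))))) (ℚ.+-identityʳ _)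
dotℚ-scaledUnit D (Fin.suc j) w = trans (cong₂ ℚ._+_ (ℚ.*-zeroˡ (w Fin.zero)) (dotℚ-scaledUnit D j (w ∘ Fin.suc))) (ℚ.+-identityˡ _)

annihilates-isSubmodule : ∀ {l} (w : Vector ℚ l) → IsSubmodule (λ v → Lℚ.dot (toℚ v) w ≡ 0ℚ)
annihilates-isSubmodule w = record
  { ≗-closed = λ {u} {v} u≗v uw≡0 → trans (Lℚ.dot-comm (toℚ v) w) (trans (Lℚ.dot-congʳ w (λ j → cong (ℚ._/ 1) (sym (u≗v j))))
                                      (trans (Lℚ.dot-comm w (toℚ u)) uw≡0))
  ; 0-closed = Lℚ.sum-zero (λ i → ℚ.*-zeroˡ (w i))
  ; +-closed = λ {u} {v} uw≡0 vw≡0 → subspace (+ 1) u v uw≡0 vw≡0 (λ j → cong (ℤ._+_ (u j)) (sym (ℤ.*-identityˡ (v j))))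
  ; *-closed = λ k {v} vw≡0 → subspace k (λ _ → 0ℤ) v (Lℚ.sum-zero (λ i → ℚ.*-zeroˡ (w i))) vw≡0 (λ j → sym (ℤ.+-identityˡ (k ℤ.* v j)))
  }
  where
  subspace : ∀ k u v → Lℚ.dot (toℚ u) w ≡ 0ℚ → Lℚ.dot (toℚ v) w ≡ 0ℚ → ∀ {x} → (∀ j → x j ≡ u j ℤ.+ k ℤ.* v j) → Lℚ.dot (toℚ x) w ≡ 0ℚ
  subspace k u v uw≡0 vw≡0 {x} x≡ = trans (Lℚ.dot-comm (toℚ x) w) (trans
    (Lℚ.dot-congʳ w (λ j → trans (cong (ℚ._/ 1) (x≡ j)) (trans (/1-homo-+ (u j) (k ℤ.* v j)) (cong (toℚ u j ℚ.+_) (/1-homo-* k (v j))))))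
    (Lℚ.hyperplane-isSubspace w (toℚ u) (toℚ v) (k ℚ./ 1) (trans (Lℚ.dot-comm w (toℚ u)) uw≡0) (trans (Lℚ.dot-comm w (toℚ v)) vw≡0)))

-- Trivial kernels over `ℚ`, modulo `p`, and luckiness

module _ {l k : ℕ} (a : Fin k → Vector ℤ l) where

  UnitsSpanned : ℤ → Set₁
  UnitsSpanned D = ∀ {P} → IsSubmodule P → (∀ i → P (a i)) → ∀ j → P (scaledUnit D j)

  trivialℚ⇒units : Trivial ℚ-ring (toℚ ∘ a) → ∃[ D ] D ≢ 0ℤ × UnitsSpanned D
  trivialℚ⇒units a≈0 =
    let D , 0∤D , spanned = eliminate 0 (λ 0∣1 → contradiction (ℤ.0∣⇒≡0 0∣1) λ ()) euclid a ker in
    D , (λ D≡0 → 0∤D (subst (0ℤ ∣_) (sym D≡0) ℤ.∣-refl)) , spanned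
    where
    0∣0 : ∀ {x} → x ≡ 0ℤ → 0ℤ ∣ x
    0∣0 refl = ℤ.∣-refl
    euclid : ∀ x y → 0ℤ ∣ x ℤ.* y → 0ℤ ∣ x ⊎ 0ℤ ∣ y
    euclid x y 0∣xy = Sum.map 0∣0 0∣0 (ℤ.i*j≡0⇒i≡0∨j≡0 x (ℤ.0∣⇒≡0 0∣xy))
    ker : ∀ v → (∀ i → 0ℤ ∣ dotℤ (a i) v) → ∀ j → 0ℤ ∣ v j
    ker v killed j = 0∣0 (/1≡0⇒≡0 (v j) (a≈0 {toℚ v} (λ i → trans (dotℚ-toℚ (a i) v) (cong (ℚ._/ 1) (ℤ.0∣⇒≡0 (killed i)))) j))

  -- The integer vectors annihilating a fixed rational `w` form a submodule. It contains the rows,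
  -- hence every unit vector times `D`, and `D` is invertible in `ℚ`. No denominators of `w` have to
  -- be cleared.
  units⇒trivialℚ : ∀ {D} → D ≢ 0ℤ → UnitsSpanned D → Trivial ℚ-ring (toℚ ∘ a)
  units⇒trivialℚ {D} D≢0 spanned {w} killed j with y , yD≡1 ← ℚ-inverse (D ℚ./ 1) (D≢0 ∘ /1≡0⇒≡0 D) = begin
    w j                      ≡⟨ ℚ.*-identityˡ (w j) ⟨
    1ℚ ℚ.* w j               ≡⟨ cong (ℚ._* w j) yD≡1 ⟨
    y ℚ.* (D ℚ./ 1) ℚ.* w j    ≡⟨ ℚ.*-assoc y (D ℚ./ 1) (w j) ⟩
    y ℚ.* (D ℚ./ 1 ℚ.* w j)  ≡⟨ cong (y ℚ.*_) (trans (sym (dotℚ-scaledUnit D j w)) (spanned (annihilates-isSubmodule w) killed j)) ⟩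
    y ℚ.* 0ℚ                 ≡⟨ ℚ.*-zeroʳ y ⟩
    0ℚ                       ∎
    where
    open ≡-Reasoning

  trivial-mod⇒units : ∀ {p} → Prime p → Trivial (ℤ/ p) a → ∃[ D ] ¬ + p ∣ D × UnitsSpanned D
  trivial-mod⇒units {p} prime-p a≈0 = eliminate p (prime∤1 prime-p) (prime-euclid prime-p) a
    (λ v killed j → ≡0⇒∣ (a≈0 {v} (λ i → ∣⇒≡0 (killed i)) j))

  p∤D⇒D≢0 : ∀ {p D} → ¬ + p ∣ D → D ≢ 0ℤ
  p∤D⇒D≢0 p∤D refl = p∤D (divides 0ℤ refl)

  trivial-mod⇒trivialℚ : ∀ {p} → Prime p → Trivial (ℤ/ p) a → Trivial ℚ-ring (toℚ ∘ a)
  trivial-mod⇒trivialℚ prime-p a≈0 with D , p∤D , spanned ← trivial-mod⇒units prime-p a≈0 =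
    units⇒trivialℚ (p∤D⇒D≢0 p∤D) spanned

  module _ (σ : TermOrdering l) {p : ℕ} (prime-p : Prime p) where

    open Gröbner σ

    private
      spanned-by-ideal : ∀ {D} → UnitsSpanned D → ∀ j → ⟨ linearForm ∘ a ⟩ (linearForm (scaledUnit D j))
      spanned-by-ideal spanned = spanned (linearForm∈-isSubmodule (⟨⟩-isIdeal (linearForm ∘ a))) (⟨⟩-generator (linearForm ∘ a))

    lucky⇒trivial-mod : Trivial ℚ-ring (toℚ ∘ a) → Lucky p ⟨ linearForm ∘ a ⟩ → Trivial (ℤ/ p) a
    lucky⇒trivial-mod a≈0 lucky {v} killed j with D , D≢0 , spanned ← trivialℚ⇒units a≈0 =
      ∣⇒≡0 (lucky⇒kernel-trivial σ a D≢0 (spanned-by-ideal spanned) (prime-euclid prime-p) lucky v (λ i → ≡0⇒∣ (killed i)) j)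

    trivial-mod⇒lucky : Trivial (ℤ/ p) a → Lucky p ⟨ linearForm ∘ a ⟩
    trivial-mod⇒lucky a≈0 with D , p∤D , spanned ← trivial-mod⇒units prime-p a≈0 =
      p∤D⇒lucky σ a (p∤D⇒D≢0 p∤D) (spanned-by-ideal spanned) p∤D

-- Good and lucky primes against combinatorial equivalence

module _ {l n : ℕ} (𝒜 : Arrangement l n) (σ : TermOrdering l) {p : ℕ} (prime-p : Prime p) where

  open Arrangement 𝒜

  lucky⇒equivalent : LuckyFor 𝒜 σ l p → CombinatoriallyEquivalentMod 𝒜 p
  lucky⇒equivalent lucky = bases-agree⇒equivalent ℚ-ring ℚ-isField (ℤ/ p) (ℤ/p-isField prime-p) (formsℚ 𝒜) α
    (λ {v} → essential v)
    -- Cutting out 0 is dimension 0, which is the codimension `l` that `LuckyFor` asks of the tuple.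
    (λ β β-incr β≈0 → lucky⇒trivial-mod (α ∘ β) σ prime-p β≈0 (lucky β β-incr (0 , Lℚ.trivial-dim β≈0 , refl)))
    (λ β _ → trivial-mod⇒trivialℚ (α ∘ β) prime-p)

  equivalent⇒lucky : CombinatoriallyEquivalentMod 𝒜 p → LuckyFor 𝒜 σ l p
  equivalent⇒lucky equivalent ι ι-incr (d , dim , d+l≡l) = trivial-mod⇒lucky (α ∘ ι) σ prime-p
    (equivalent⇒trivial ℚ-ring ℚ-isField (ℤ/ p) (ℤ/p-isField prime-p) (formsℚ 𝒜) α equivalent ι ι-incr
      (subst (Linear.HasDim ℚ-ring _) (ℕ.+-cancelʳ-≡ l d 0 d+l≡l) dim))

  -- A relation `α_i = c α_i′` mod `p` directly gives only one inclusion of hyperplanes mod `p`, as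
  -- `c` may be 0. By `equivalent⇒≐` this is enough to identify the rational hyperplanes, which are
  -- distinct.
  equivalent⇒good : CombinatoriallyEquivalentMod 𝒜 p → Good 𝒜 p
  equivalent⇒good equivalent {i} {i′} i<i′ (c , α≡cα′) = distinct (λ { refl → ℕ.<-irrefl refl i<i′ })
    (equivalent⇒≐ ℚ-ring ℚ-isField (ℤ/ p) (ℤ/p-isField prime-p) (formsℚ 𝒜) α equivalent i<i′
      (nonzeroℚ i) (nonzeroℚ i′) (λ {v} → H⊆ v))
    where
    nonzeroℚ : ∀ i → ∃[ j ] toℚ (α i) j ≢ 0ℚ
    nonzeroℚ i = let j , αⱼ≢0 = nonzero i in j , αⱼ≢0 ∘ /1≡0⇒≡0 (α i j)

    lemma : ∀ c x y → c ℤ.* y ℤ.+ (+ 1 ℤ.* x ℤ.- c ℤ.* y) ≡ x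
    lemma = ℤ-Solver.solve-∀

    p∣α-cα′ : ∀ j → + p ∣ + 1 ℤ.* α i j ℤ.- c ℤ.* α i′ j
    p∣α-cα′ j = subst (λ x → + p ∣ x ℤ.- c ℤ.* α i′ j) (sym (ℤ.*-identityˡ (α i j))) (_≡_[mod_].p∣a-b (α≡cα′ j))

    H⊆ : ∀ v → Linear.Hyperplane (ℤ/ p) (α i′) v → Linear.Hyperplane (ℤ/ p) (α i) v
    H⊆ v α′v≡0 = ∣⇒≡0 (subst (+ p ∣_)
      (trans (cong (λ z → c ℤ.* dotℤ (α i′) v ℤ.+ z) (dotℤ-combineˡ (+ 1) c (α i) (α i′) v)) (lemma c (dotℤ (α i) v) (dotℤ (α i′) v)))
      (∣m∣n⇒∣m+n (∣n⇒∣m*n c (≡0⇒∣ α′v≡0))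
        (∣-sum {f = λ j → (+ 1 ℤ.* α i j ℤ.- c ℤ.* α i′ j) ℤ.* v j} (λ j → ∣m⇒∣m*n (v j) (p∣α-cα′ j)))))

theorem4p14 : ∀ {l n : ℕ} (𝒜 : Arrangement l n) (σ : TermOrdering l) (p : ℕ) → Prime p →
    (Good 𝒜 p × LuckyFor 𝒜 σ l p) ⇔ CombinatoriallyEquivalentMod 𝒜 p
theorem4p14 𝒜 σ p prime-p = mk⇔
  (λ (_ , lucky) {k} → lucky⇒equivalent 𝒜 σ prime-p lucky {k})
  (λ equivalent → (λ {i} {i′} → equivalent⇒good 𝒜 σ prime-p equivalent {i} {i′}) , equivalent⇒lucky 𝒜 σ prime-p equivalent)
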